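{- For every $w\in S_{\mathbb Z}$, the shifted SEM expansion of $\mathfrak S_{\gamma^m(w)}$ has constant support and coefficients for all sufficiently large $m$. That is, there exist an integer $m_0\ge 0$, a finite set $A\subset\mathcal C$ and nonzero rational numbers $(c_\alpha)_{\alpha\in A}$ such that for every integer $m\ge m_0$: $\gamma^m(w)\in S_\infty$, the index $\gamma^m(\alpha)$ is admissible for every $\alpha\in A$, and $$\mathfrak S_{\gamma^m(w)}=\sum_{\alpha\in A}c_\alpha\,\mathbf e_{\gamma^m(\alpha)}.$$
   Context: Indices. $\mathcal C$ is the set of finitely supported tuples $\alpha=(\alpha_i)_{i\in\mathbb Z}$ of nonnegative integers, with shift $\gamma(\alpha)_i=\alpha_{i-1}$. Ordinary SEMs. An index $a\in\mathcal C$ is admissible if it is supported on positive integers and $a_i\le i$ for all $i\ge 1$; then $\mathbf e_a=\prod_{i\ge 1}\mathbf e_{a_i}(x_1,\ldots,x_i)$, a product of elementary symmetric polynomials, is the ordinary standard elementary monomial (SEM). The ordinary SEMs form a $\mathbb Q$-basis of $\mathbb Q[x_1,x_2,\ldots]$ (Fomin–Gelfand–Postnikov). Permutations. $S_{\mathbb Z}$ is the group of permutations of $\mathbb Z$ moving only finitely many integers; $S_\infty\subset S_{\mathbb Z}$ is the subgroup of those fixing every $i\le 0$; $s_i=(i,i+1)$; $\ell$ is Coxeter length. The shift acts on $S_{\mathbb Z}$ by $\gamma(w)(i)=w(i-1)+1$. Schubert polynomials. For $u\in S_\infty$, $\mathfrak S_u$ is the usual Schubert polynomial: $\mathfrak S_{w_0}=x_1^{n-1}x_2^{n-2}\cdots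 x_{n-1}$ for the longest $w_0\in S_n$, and $\partial_i\mathfrak S_u=\mathfrak S_{us_i}$ whenever $\ell(us_i)<\ell(u)$, where $\partial_i f=(f-s_if)/(x_i-x_{i+1})$. -}

module Defs where

open import Algebra.Bundles using (CommutativeRing)
open import Data.Bool using (if_then_else_)
open import Data.Empty using (⊥-elim)
open import Data.Integer using (ℤ; +_; -[1+_]; +[1+_]; ∣_∣; pred; 0ℤ; 1ℤ) renaming (suc to sucℤ)
open import Data.List using (List; []; _∷_; _++_; map; foldr; length; upTo)
open import Data.Nat using (ℕ; zero; suc; _⊔_)
open import Data.Nat.GeneralisedArithmetic using (fold)
open import Data.Product using (∃-syntax; _×_; _,_; proj₁; proj₂)
open import Data.Rational using (ℚ; 0ℚ; 1ℚ)
open import Function using (_↔_; Inverse; mk↔ₛ′)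
open import Function.Construct.Composition using (_↔-∘_)
open import Function.Construct.Identity using (↔-id)
open import Level using (0ℓ)
open import Relation.Binary using (DecidableEquality; Setoid)
open import Relation.Binary.PropositionalEquality using (_≡_; refl; sym; trans; cong; subst; _≗_)
open import Relation.Nullary using (¬_; Dec; does; yes; no; _×-dec_)
open import Relation.Nullary.Decidable using (dec-true; dec-false)

import Data.Integer as ℤ
import Data.Integer.Properties as ℤ
import Data.Nat as ℕ
import Data.Nat.Properties as ℕ
import Data.Rational as ℚ

transposition : {A : Set} → DecidableEquality A → A → A → A → A
transposition _≟_ a b c =
  if does (c ≟ a) then b else if does (c ≟ b) then a else c

transposition-involutive : {A : Set} (_≟_ : DecidableEquality A) (a b c : A) →
  transposition _≟_ a b (transposition _≟_ a b c) ≡ c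
transposition-involutive _≟_ a b c with c ≟ a
... | yes c≡a with b ≟ a
...   | yes b≡a = trans b≡a (sym c≡a)
...   | no  _ with b ≟ b
...     | yes _  = sym c≡a
...     | no b≢b = ⊥-elim (b≢b refl)
transposition-involutive _≟_ a b c | no c≢a with c ≟ b
... | yes c≡b with a ≟ a
...   | yes _  = sym c≡b
...   | no a≢a = ⊥-elim (a≢a refl)
transposition-involutive _≟_ a b c | no c≢a | no c≢b with c ≟ a
... | yes c≡a = ⊥-elim (c≢a c≡a)
... | no _ with c ≟ b
...   | yes c≡b = ⊥-elim (c≢b c≡b)
...   | no _    = refl

transposition-fixes : {A : Set} (_≟_ : DecidableEquality A) {a b c : A} →
  (c ≡ a → c ≡ b) → (c ≡ b → c ≡ a) → transposition _≟_ a b c ≡ c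
transposition-fixes _≟_ {a} {b} {c} ab ba with c ≟ a
... | yes c≡a = sym (ab c≡a)
... | no _ with c ≟ b
...   | yes c≡b = sym (ba c≡b)
...   | no _    = refl

∣i∣≤1+∣pred-i∣ : ∀ i → ∣ i ∣ ℕ.≤ suc ∣ pred i ∣
∣i∣≤1+∣pred-i∣ i =
  subst (λ j → ∣ j ∣ ℕ.≤ suc ∣ pred i ∣) (ℤ.suc-pred i) (ℤ.∣i+j∣≤∣i∣+∣j∣ 1ℤ (pred i))

------------------------------------------------------------------------
-- Indices

record 𝒞 : Set where
  field
    at      : ℤ → ℕ
    bound   : ℕ
    support : ∀ i → bound ℕ.< ∣ i ∣ → at i ≡ 0

open 𝒞 public using (at)

𝒞-setoid : Setoid 0ℓ 0ℓ
𝒞-setoid = record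
  { Carrier       = 𝒞
  ; _≈_           = λ α β → at α ≗ at β
  ; isEquivalence = record
    { refl  = λ _ → refl
    ; sym   = λ p i → sym (p i)
    ; trans = λ p q i → trans (p i) (q i)
    }
  }

γ : 𝒞 → 𝒞
γ α = record
  { at      = λ i → at α (pred i)
  ; bound   = suc (𝒞.bound α)
  ; support = λ i b<i →
      𝒞.support α (pred i) (ℕ.≤-pred (ℕ.≤-trans b<i (∣i∣≤1+∣pred-i∣ i)))
  }

γ^ : ℕ → 𝒞 → 𝒞
γ^ m α = fold α γ m

record Admissible (a : 𝒞) : Set where
  field
    positive : ∀ i → i ℤ.≤ 0ℤ → at a i ≡ 0
    bounded  : ∀ i → 1ℤ ℤ.≤ i → + at a i ℤ.≤ i

------------------------------------------------------------------------
-- Permutations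

record Sℤ : Set where
  field
    perm  : ℤ ↔ ℤ
    bound : ℕ
    fixes : ∀ i → bound ℕ.< ∣ i ∣ → Inverse.to perm i ≡ i

infixl 20 _⟨$⟩_
_⟨$⟩_ : Sℤ → ℤ → ℤ
w ⟨$⟩ i = Inverse.to (Sℤ.perm w) i

infix 4 _≈ˢ_
_≈ˢ_ : Sℤ → Sℤ → Set
u ≈ˢ v = ∀ i → u ⟨$⟩ i ≡ v ⟨$⟩ i

idˢ : Sℤ
idˢ = record { perm = ↔-id ℤ ; bound = 0 ; fixes = λ _ _ → refl }

infixl 7 _∙_
_∙_ : Sℤ → Sℤ → Sℤ
u ∙ v = record
  { perm  = Sℤ.perm u ↔-∘ Sℤ.perm v
  ; bound = Sℤ.bound u ⊔ Sℤ.bound v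
  ; fixes = λ i b<i → trans
      (cong (u ⟨$⟩_) (Sℤ.fixes v i (ℕ.≤-<-trans (ℕ.m≤n⊔m (Sℤ.bound u) (Sℤ.bound v)) b<i)))
      (Sℤ.fixes u i (ℕ.≤-<-trans (ℕ.m≤m⊔n (Sℤ.bound u) (Sℤ.bound v)) b<i))
  }

s : ℤ → Sℤ
s i = record
  { perm  = mk↔ₛ′ t t t-inv t-inv
  ; bound = ∣ i ∣ ⊔ ∣ sucℤ i ∣
  ; fixes = λ j b<j → transposition-fixes ℤ._≟_
      (λ { refl → ⊥-elim (ℕ.<-irrefl refl (ℕ.≤-<-trans (ℕ.m≤m⊔n _ _) b<j)) })
      (λ { refl → ⊥-elim (ℕ.<-irrefl refl (ℕ.≤-<-trans (ℕ.m≤n⊔m ∣ i ∣ _) b<j)) })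
  }
  where
  t     = transposition ℤ._≟_ i (sucℤ i)
  t-inv = transposition-involutive ℤ._≟_ i (sucℤ i)

γˢ : Sℤ → Sℤ
γˢ w = record
  { perm  = shift ↔-∘ (Sℤ.perm w ↔-∘ unshift)
  ; bound = suc (Sℤ.bound w)
  ; fixes = λ i b<i → trans
      (cong sucℤ (Sℤ.fixes w (pred i) (ℕ.≤-pred (ℕ.≤-trans b<i (∣i∣≤1+∣pred-i∣ i)))))
      (ℤ.suc-pred i)
  }
  where
  shift unshift : ℤ ↔ ℤ
  shift   = mk↔ₛ′ sucℤ pred ℤ.suc-pred ℤ.pred-suc
  unshift = mk↔ₛ′ pred sucℤ ℤ.pred-suc ℤ.suc-pred

γˢ^ : ℕ → Sℤ → Sℤ
γˢ^ m w = fold w γˢ m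

_∈S∞ : Sℤ → Set
w ∈S∞ = ∀ i → i ℤ.≤ 0ℤ → w ⟨$⟩ i ≡ i

∏s : List ℤ → Sℤ
∏s = foldr (λ i w → s i ∙ w) idˢ

record IsCoxeterLength (w : Sℤ) (n : ℕ) : Set where
  field
    word    : List ℤ
    product : ∏s word ≈ˢ w
    size    : length word ≡ n
    minimal : ∀ word′ → ∏s word′ ≈ˢ w → n ℕ.≤ length word′

infix 4 _<ℓ_
_<ℓ_ : Sℤ → Sℤ → Set
u <ℓ v = ∃[ p ] ∃[ q ] IsCoxeterLength u p × IsCoxeterLength v q × p ℕ.< q

InRange : ℕ → ℤ → Set
InRange n i = 1ℤ ℤ.≤ i × i ℤ.≤ + n

inRange? : ∀ n i → Dec (InRange n i)
inRange? n i = (1ℤ ℤ.≤? i) ×-dec (i ℤ.≤? + n)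

reversal : ℕ → ℤ → ℤ
reversal n i = if does (inRange? n i) then + suc n ℤ.- i else i

private
  flip-flip : ∀ (a i : ℤ) → a ℤ.- (a ℤ.- i) ≡ i
  flip-flip a i = trans (cong (λ z → a ℤ.+ z) (ℤ.neg-distrib-+ a (ℤ.- i)))
    (trans (sym (ℤ.+-assoc a (ℤ.- a) (ℤ.- (ℤ.- i))))
    (trans (cong (ℤ._+ ℤ.- (ℤ.- i)) (ℤ.+-inverseʳ a))
    (trans (ℤ.+-identityˡ _) (ℤ.neg-involutive i))))

  flip-inRange : ∀ n i → InRange n i → InRange n (+ suc n ℤ.- i)
  flip-inRange n i (1≤i , i≤n) =
      subst (ℤ._≤ + suc n ℤ.- i) (trans (ℤ.+-assoc 1ℤ (+ n) (ℤ.- (+ n))) (cong sucℤ (ℤ.+-inverseʳ (+ n))))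
        (ℤ.+-monoʳ-≤ (+ suc n) (ℤ.neg-mono-≤ i≤n))
    , ℤ.+-monoʳ-≤ (+ suc n) (ℤ.neg-mono-≤ 1≤i)

reversal-inside : ∀ n i → InRange n i → reversal n i ≡ + suc n ℤ.- i
reversal-inside n i r = cong (if_then + suc n ℤ.- i else i) (dec-true (inRange? n i) r)

reversal-outside : ∀ n i → ¬ InRange n i → reversal n i ≡ i
reversal-outside n i ¬r = cong (if_then + suc n ℤ.- i else i) (dec-false (inRange? n i) ¬r)

reversal-involutive : ∀ n i → reversal n (reversal n i) ≡ i
reversal-involutive n i = by-cases (inRange? n i)
  where
  by-cases : Dec (InRange n i) → reversal n (reversal n i) ≡ i
  by-cases (yes r) = trans (cong (reversal n) (reversal-inside n i r))
    (trans (reversal-inside n _ (flip-inRange n i r)) (flip-flip (+ suc n) i))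
  by-cases (no ¬r) = trans (cong (reversal n) (reversal-outside n i ¬r)) (reversal-outside n i ¬r)

reversal-fixes : ∀ n i → n ℕ.< ∣ i ∣ → reversal n i ≡ i
reversal-fixes n i n<i = reversal-outside n i (λ r → ℕ.<⇒≱ n<i (small i r))
  where
  small : ∀ i → InRange n i → ∣ i ∣ ℕ.≤ n
  small (+ k)    (_ , ℤ.+≤+ k≤n) = k≤n
  small -[1+ k ] (() , _)

-- the longest element n (n-1) … 1 of S_n
w₀ : ℕ → Sℤ
w₀ n = record
  { perm  = mk↔ₛ′ (reversal n) (reversal n) (reversal-involutive n) (reversal-involutive n)
  ; bound = n
  ; fixes = reversal-fixes n
  }

------------------------------------------------------------------------
-- ℚ[x₁, x₂, …], presented as the free commutative ℚ-algebra on its variables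

infixl 6 _+_ _-_
infixl 7 _*_
infix  8 -_
infix  4 _≈_

-- var k is the variable x_{k+1}.
data Poly : Set where
  con     : ℚ → Poly
  var     : ℕ → Poly
  _+_ _*_ : Poly → Poly → Poly
  -_      : Poly → Poly

data _≈_ : Poly → Poly → Set where
  ≈-refl      : ∀ {f} → f ≈ f
  ≈-sym       : ∀ {f g} → f ≈ g → g ≈ f
  ≈-trans     : ∀ {f g h} → f ≈ g → g ≈ h → f ≈ h
  +-cong      : ∀ {f f′ g g′} → f ≈ f′ → g ≈ g′ → f + g ≈ f′ + g′
  *-cong      : ∀ {f f′ g g′} → f ≈ f′ → g ≈ g′ → f * g ≈ f′ * g′
  -‿cong      : ∀ {f f′} → f ≈ f′ → - f ≈ - f′
  +-assoc     : ∀ f g h → (f + g) + h ≈ f + (g + h)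
  +-comm      : ∀ f g → f + g ≈ g + f
  +-identityˡ : ∀ f → con 0ℚ + f ≈ f
  -‿inverseˡ  : ∀ f → - f + f ≈ con 0ℚ
  *-assoc     : ∀ f g h → (f * g) * h ≈ f * (g * h)
  *-comm      : ∀ f g → f * g ≈ g * f
  *-identityˡ : ∀ f → con 1ℚ * f ≈ f
  distribˡ    : ∀ f g h → f * (g + h) ≈ f * g + f * h
  con-+       : ∀ p q → con (p ℚ.+ q) ≈ con p + con q
  con-*       : ∀ p q → con (p ℚ.* q) ≈ con p * con q

Poly-commutativeRing : CommutativeRing 0ℓ 0ℓ
Poly-commutativeRing = record
  { Carrier = Poly
  ; _≈_ = _≈_
  ; _+_ = _+_
  ; _*_ = _*_
  ; -_ = -_
  ; 0# = con 0ℚ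
  ; 1# = con 1ℚ
  ; isCommutativeRing = record
    { isRing = record
      { +-isAbelianGroup = record
        { isGroup = record
          { isMonoid = record
            { isSemigroup = record
              { isMagma = record
                { isEquivalence = record { refl = ≈-refl ; sym = ≈-sym ; trans = ≈-trans }
                ; ∙-cong = +-cong
                }
              ; assoc = +-assoc
              }
            ; identity = +-identityˡ , λ f → ≈-trans (+-comm f _) (+-identityˡ f)
            }
          ; inverse = -‿inverseˡ , λ f → ≈-trans (+-comm f _) (-‿inverseˡ f)
          ; ⁻¹-cong = -‿cong
          }
        ; comm = +-comm
        }
      ; *-cong = *-cong
      ; *-assoc = *-assoc
      ; *-identity = *-identityˡ , λ f → ≈-trans (*-comm f _) (*-identityˡ f)
      ; distrib = distribˡ , λ f g h →
          ≈-trans (*-comm _ f) (≈-trans (distribˡ f g h) (+-cong (*-comm f g) (*-comm f h)))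
      }
    ; *-comm = *-comm
    }
  }

open import Algebra.Properties.Semiring.Exp (CommutativeRing.semiring Poly-commutativeRing) public using (_^_)

_-_ : Poly → Poly → Poly
f - g = f + - g

∑ ∏ : List Poly → Poly
∑ = foldr _+_ (con 0ℚ)
∏ = foldr _*_ (con 1ℚ)

rename : (ℕ → ℕ) → Poly → Poly
rename σ (con q) = con q
rename σ (var k) = var (σ k)
rename σ (f + g) = rename σ f + rename σ g
rename σ (f * g) = rename σ f * rename σ g
rename σ (- f)   = - rename σ f

-- the action of s_{k+1}, exchanging x_{k+1} and x_{k+2}
swapVars : ℕ → Poly → Poly
swapVars k = rename (transposition ℕ._≟_ k (suc k))

-- g = ∂_{k+1} f
IsDividedDifference : ℕ → Poly → Poly → Set
IsDividedDifference k f g = (var k - var (suc k)) * g ≈ f - swapVars k f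

------------------------------------------------------------------------
-- Standard elementary monomials

choose : {A : Set} → ℕ → List A → List (List A)
choose zero    xs       = [] ∷ []
choose (suc p) []       = []
choose (suc p) (x ∷ xs) = map (x ∷_) (choose p xs) ++ choose (suc p) xs

-- e_p(x₁, …, xₙ)
e : ℕ → ℕ → Poly
e p n = ∑ (map ∏ (choose p (map var (upTo n))))

-- The factors with i > bound are e_0 = 1.
SEM : 𝒞 → Poly
SEM a = ∏ (map (λ k → e (at a +[1+ k ]) (suc k)) (upTo (𝒞.bound a)))

SEMcombination : List (𝒞 × ℚ) → Poly
SEMcombination ts = ∑ (map (λ t → con (proj₂ t) * SEM (proj₁ t)) ts)

shiftIndices : ℕ → List (𝒞 × ℚ) → List (𝒞 × ℚ)
shiftIndices m = map (λ t → γ^ m (proj₁ t) , proj₂ t)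

------------------------------------------------------------------------
-- Schubert polynomials

-- x₁^(n-1) x₂^(n-2) ⋯ x_{n-1}
staircase : ℕ → Poly
staircase n = ∏ (map (λ k → var k ^ (n ℕ.∸ suc k)) (upTo (n ℕ.∸ 1)))

-- IsSchubert u f says 𝔖_u = f: it is generated by the value at the longest
-- elements w₀ and the rule ∂_i 𝔖_u = 𝔖_{u s_i} for ℓ(u s_i) < ℓ(u), i = k + 1.
-- Every u it relates lies in S_∞, and it determines f up to _≈_ by the
-- well-definedness of Schubert polynomials.
data IsSchubert : Sℤ → Poly → Set where
  longest : ∀ n {u f} → u ≈ˢ w₀ n → f ≈ staircase n → IsSchubert u f
  descend : ∀ k {u v f g} → IsSchubert u f →
            v ≈ˢ u ∙ s +[1+ k ] → u ∙ s +[1+ k ] <ℓ u →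
            IsDividedDifference k f g → IsSchubert v g

{-# OPTIONS --safe #-}
module Submission where

-- Let u be a permutation of {1, …, n}. The permutation u(1)+1, …, u(n)+1, 1 has Schubert
-- polynomial x_1 ⋯ x_n 𝔖_u, and moving the value 1 to the front gives
--     𝔖_{γ(u)} = ∂_1 ∂_2 ⋯ ∂_n (x_1 ⋯ x_n 𝔖_u).
-- Since ∂_k e_p(x_1…x_k) = e_{p-1}(x_1…x_{k-1}) while ∂_k is linear over e_p(x_1…x_i), i ≠ k,
-- and since e_p(x_1…x_k) e_q(x_1…x_k) is a combination of products
-- e_r(x_1…x_k) e_s(x_1…x_{k+1}), the right-hand side maps a SEM with indices on [m, n-1] to
-- a combination of SEMs of the same degree with indices on [m+1, n]. As soon as the degree
-- is less than m, all terms but one vanish for degree reasons and the image of e_a is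
-- exactly e_{γ(a)}, so the expansion is stable from then on. For m = 0 the expansion comes
-- from the staircase e_1(x_1) e_2(x_1,x_2) ⋯ by applying the ∂_k.

open import Defs
open import Algebra.Bundles using (module CommutativeRing)
open import Algebra.Solver.Ring.AlmostCommutativeRing using (fromCommutativeRing; _-Raw-AlmostCommutative⟶_)
open import Data.Bool using (if_then_else_)
open import Data.Empty using (⊥; ⊥-elim)
open import Data.Integer as ℤ using (ℤ; +_; -[1+_]; +[1+_]; ∣_∣; 0ℤ; 1ℤ) renaming (suc to sucℤ)
open import Data.List using (List; []; _∷_; _++_; _∷ʳ_; map; length; upTo; downFrom)
open import Data.List.Relation.Unary.All as All using (All; []; _∷_)
open import Data.List.Relation.Unary.AllPairs using (AllPairs; []; _∷_)
open import Data.List.Relation.Unary.Unique.Setoid 𝒞-setoid using (Unique)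
open import Data.Nat as ℕ using (ℕ; zero; suc; s≤s; z≤n; _≤_)
open import Data.Nat.GeneralisedArithmetic using (fold-+)
open import Data.Nat.ListAction using (sum)
open import Data.Product using (Σ-syntax; _×_; _,_; proj₁; proj₂; map₂)
open import Data.Rational as ℚ using (ℚ; 0ℚ; 1ℚ)
open import Data.Sum using (_⊎_; inj₁; inj₂)
open import Function using (_∘_; id; Inverse)
open import Relation.Binary using (DecidableEquality; tri<; tri≈; tri>)
open import Relation.Binary.PropositionalEquality using (_≡_; _≢_; refl; sym; trans; cong; cong₂; subst; subst₂; _≗_; module ≡-Reasoning)
open import Relation.Nullary using (Dec; yes; no; does; ¬_; _×-dec_)
open import Relation.Nullary.Decidable using (dec⇒maybe; dec-true; dec-false)

import Algebra.Properties.CommutativeSemigroup as CommutativeSemigroupProperties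
import Algebra.Properties.Ring as RingProperties
import Data.Integer.Properties as ℤ
import Data.List.Properties as List
import Data.List.Relation.Unary.All.Properties as All
import Data.Maybe as Maybe
import Data.Nat.Properties as ℕ
import Data.Nat.Solver as ℕ
import Data.Rational.Properties as ℚ
import Relation.Binary.Reasoning.Setoid as SetoidReasoning

-- A polynomial is a term modulo the congruence generated by the ring axioms, so neither
-- coefficients nor a degree can be read off it. Hence `∂` is defined on terms by the twisted
-- Leibniz rule and shown to respect `≈`, and degree arguments run on index lists: `Span` records
-- which lists may occur in an expansion, and an expansion with no allowed list is zero. Multiplying
-- by e_k(x_1...x_k) and applying `T k` preserves the degree, so one bound d on the degrees in the
-- first expansion serves for all shifts. The normal form is computed once, on a window starting at
-- d + 1; from there the same list of coefficients is carried along, which gives the constant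
-- support. The threshold is thus d + 1, plus the b shifts that bring w into S_∞. `IsSchubert`
-- compares true Coxeter lengths, minimal over words in all s_i with i in ℤ; inversions and sorting
-- supply them.

module P = CommutativeRing Poly-commutativeRing
module PR = RingProperties P.ring
module ≈-Reasoning = SetoidReasoning P.setoid

0ᴾ 1ᴾ : Poly
0ᴾ = con 0ℚ
1ᴾ = con 1ℚ

≡⇒≈ : ∀ {f g} → f ≡ g → f ≈ g
≡⇒≈ refl = ≈-refl

con-neg : ∀ q → con (ℚ.- q) ≈ - con q
con-neg q = PR.+-inverseˡ-unique (con (ℚ.- q)) (con q)
  (≈-trans (≈-sym (con-+ (ℚ.- q) q)) (≡⇒≈ (cong con (ℚ.+-inverseˡ q))))

con-homo : ℚ.+-*-rawRing -Raw-AlmostCommutative⟶ fromCommutativeRing Poly-commutativeRing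
con-homo = record
  { ⟦_⟧ = con ; +-homo = con-+ ; *-homo = con-* ; -‿homo = con-neg
  ; 0-homo = ≈-refl ; 1-homo = ≈-refl }

open import Algebra.Solver.Ring ℚ.+-*-rawRing (fromCommutativeRing Poly-commutativeRing) con-homo
  (λ p q → Maybe.map (≡⇒≈ ∘ cong con) (dec⇒maybe (p ℚ.≟ q)))
  using (solve; _:+_; _:*_; _:-_; :-_; _:=_) renaming (con to :con)

*-congˡ : ∀ {f g h} → g ≈ h → f * g ≈ f * h
*-congˡ = *-cong ≈-refl

*-congʳ : ∀ {f g h} → g ≈ h → g * f ≈ h * f
*-congʳ p = *-cong p ≈-refl

-- Divided differences as operators on polynomials

rename-cong : ∀ σ {f g} → f ≈ g → rename σ f ≈ rename σ g
rename-cong σ ≈-refl = ≈-refl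
rename-cong σ (≈-sym p) = ≈-sym (rename-cong σ p)
rename-cong σ (≈-trans p q) = ≈-trans (rename-cong σ p) (rename-cong σ q)
rename-cong σ (+-cong p q) = +-cong (rename-cong σ p) (rename-cong σ q)
rename-cong σ (*-cong p q) = *-cong (rename-cong σ p) (rename-cong σ q)
rename-cong σ (-‿cong p) = -‿cong (rename-cong σ p)
rename-cong σ (+-assoc f g h) = +-assoc _ _ _
rename-cong σ (+-comm f g) = +-comm _ _
rename-cong σ (+-identityˡ f) = +-identityˡ _
rename-cong σ (-‿inverseˡ f) = -‿inverseˡ _
rename-cong σ (*-assoc f g h) = *-assoc _ _ _
rename-cong σ (*-comm f g) = *-comm _ _
rename-cong σ (*-identityˡ f) = *-identityˡ _
rename-cong σ (distribˡ f g h) = distribˡ _ _ _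
rename-cong σ (con-+ p q) = con-+ p q
rename-cong σ (con-* p q) = con-* p q

-- ∂ k is the divided difference ∂_{k+1}, as var k is x_{k+1}.
∂ : ℕ → Poly → Poly
∂ k (con q) = 0ᴾ
∂ k (var j) = if does (j ℕ.≟ k) then 1ᴾ else if does (j ℕ.≟ suc k) then - 1ᴾ else 0ᴾ
∂ k (f + g) = ∂ k f + ∂ k g
∂ k (f * g) = ∂ k f * g + swapVars k f * ∂ k g
∂ k (- f)   = - ∂ k f

swap-var-left : ∀ k → swapVars k (var k) ≡ var (suc k)
swap-var-left k rewrite dec-true (k ℕ.≟ k) refl = refl

swap-var-right : ∀ k → swapVars k (var (suc k)) ≡ var k
swap-var-right k rewrite dec-false (suc k ℕ.≟ k) ℕ.1+n≢n | dec-true (suc k ℕ.≟ suc k) refl = refl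

swap-var-≢ : ∀ {k j} → j ≢ k → j ≢ suc k → swapVars k (var j) ≡ var j
swap-var-≢ {k} {j} j≢k j≢1+k rewrite dec-false (j ℕ.≟ k) j≢k | dec-false (j ℕ.≟ suc k) j≢1+k = refl

∂-var-left : ∀ k → ∂ k (var k) ≡ 1ᴾ
∂-var-left k rewrite dec-true (k ℕ.≟ k) refl = refl

∂-var-right : ∀ k → ∂ k (var (suc k)) ≡ - 1ᴾ
∂-var-right k rewrite dec-false (suc k ℕ.≟ k) ℕ.1+n≢n | dec-true (suc k ℕ.≟ suc k) refl = refl

∂-var-≢ : ∀ {k j} → j ≢ k → j ≢ suc k → ∂ k (var j) ≡ 0ᴾ
∂-var-≢ {k} {j} j≢k j≢1+k rewrite dec-false (j ℕ.≟ k) j≢k | dec-false (j ℕ.≟ suc k) j≢1+k = refl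

∂-isDividedDifference-var : ∀ k j → Dec (j ≡ k) → Dec (j ≡ suc k) → IsDividedDifference k (var j) (∂ k (var j))
∂-isDividedDifference-var k .k (yes refl) _ rewrite swap-var-left k | ∂-var-left k = P.*-identityʳ _
∂-isDividedDifference-var k .(suc k) (no _) (yes refl) rewrite swap-var-right k | ∂-var-right k =
  solve 2 (λ x y → (x :- y) :* (:- :con 1ℚ) := y :- x) ≈-refl (var k) (var (suc k))
∂-isDividedDifference-var k j (no j≢k) (no j≢1+k) rewrite swap-var-≢ j≢k j≢1+k | ∂-var-≢ j≢k j≢1+k =
  solve 3 (λ x y z → (x :- y) :* :con 0ℚ := z :- z) ≈-refl (var k) (var (suc k)) (var j)

∂-isDividedDifference : ∀ k f → IsDividedDifference k f (∂ k f)
∂-isDividedDifference k (con q) =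
  solve 3 (λ x y c → (x :- y) :* :con 0ℚ := c :- c) ≈-refl (var k) (var (suc k)) (con q)
∂-isDividedDifference k (var j) = ∂-isDividedDifference-var k j (j ℕ.≟ k) (j ℕ.≟ suc k)
∂-isDividedDifference k (f + g) = begin
  Δ * (∂ k f + ∂ k g)                           ≈⟨ distribˡ _ _ _ ⟩
  Δ * ∂ k f + Δ * ∂ k g                         ≈⟨ +-cong (∂-isDividedDifference k f) (∂-isDividedDifference k g) ⟩
  (f - swapVars k f) + (g - swapVars k g)       ≈⟨ solve 4 (λ f g f′ g′ → (f :- f′) :+ (g :- g′) := (f :+ g) :- (f′ :+ g′)) ≈-refl f g _ _ ⟩
  (f + g) - (swapVars k f + swapVars k g)       ∎
  where open ≈-Reasoning
        Δ = var k - var (suc k)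
∂-isDividedDifference k (f * g) = begin
  Δ * (∂ k f * g + f′ * ∂ k g)         ≈⟨ solve 5 (λ d a b c e → d :* (a :* b :+ c :* e) := (d :* a) :* b :+ c :* (d :* e)) ≈-refl Δ (∂ k f) g f′ (∂ k g) ⟩
  (Δ * ∂ k f) * g + f′ * (Δ * ∂ k g)   ≈⟨ +-cong (*-congʳ (∂-isDividedDifference k f)) (*-congˡ (∂-isDividedDifference k g)) ⟩
  (f - f′) * g + f′ * (g - g′)         ≈⟨ solve 4 (λ f g f′ g′ → (f :- f′) :* g :+ f′ :* (g :- g′) := f :* g :- f′ :* g′) ≈-refl f g f′ g′ ⟩
  f * g - f′ * g′                      ∎
  where open ≈-Reasoning
        Δ = var k - var (suc k)
        f′ = swapVars k f
        g′ = swapVars k g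
∂-isDividedDifference k (- f) = begin
  Δ * - ∂ k f          ≈⟨ solve 2 (λ d a → d :* (:- a) := :- (d :* a)) ≈-refl Δ (∂ k f) ⟩
  - (Δ * ∂ k f)        ≈⟨ -‿cong (∂-isDividedDifference k f) ⟩
  - (f - swapVars k f) ≈⟨ solve 2 (λ f f′ → :- (f :- f′) := (:- f) :- (:- f′)) ≈-refl f (swapVars k f) ⟩
  - f - - swapVars k f ∎
  where open ≈-Reasoning
        Δ = var k - var (suc k)

-- The twisted Leibniz rule treats its two factors differently. The two orders differ by
-- `∂ k f * (g - g′) - ∂ k g * (f - f′)`, and by `∂-isDividedDifference` both products equal
-- `Δ * (∂ k f * ∂ k g)`.
∂-*-comm : ∀ k f g → ∂ k (f * g) ≈ ∂ k (g * f)
∂-*-comm k f g = begin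
  ∂ k f * g + f′ * ∂ k g
    ≈⟨ solve 5 (λ a g f′ b g′ → a :* g :+ f′ :* b := (a :* g′ :+ a :* (g :- g′)) :+ f′ :* b) ≈-refl (∂ k f) g f′ (∂ k g) g′ ⟩
  (∂ k f * g′ + ∂ k f * (g - g′)) + f′ * ∂ k g
    ≈⟨ +-cong (+-cong ≈-refl (*-congˡ (≈-sym (∂-isDividedDifference k g)))) ≈-refl ⟩
  (∂ k f * g′ + ∂ k f * (Δ * ∂ k g)) + f′ * ∂ k g
    ≈⟨ solve 5 (λ a g′ d b f′ → (a :* g′ :+ a :* (d :* b)) :+ f′ :* b := (b :* (d :* a) :+ b :* f′) :+ g′ :* a) ≈-refl (∂ k f) g′ Δ (∂ k g) f′ ⟩
  (∂ k g * (Δ * ∂ k f) + ∂ k g * f′) + g′ * ∂ k f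
    ≈⟨ +-cong (+-cong (*-congˡ (∂-isDividedDifference k f)) ≈-refl) ≈-refl ⟩
  (∂ k g * (f - f′) + ∂ k g * f′) + g′ * ∂ k f
    ≈⟨ solve 5 (λ b f f′ g′ a → (b :* (f :- f′) :+ b :* f′) :+ g′ :* a := b :* f :+ g′ :* a) ≈-refl (∂ k g) f f′ g′ (∂ k f) ⟩
  ∂ k g * f + g′ * ∂ k f ∎
  where open ≈-Reasoning
        Δ = var k - var (suc k)
        f′ = swapVars k f
        g′ = swapVars k g

-- Induction on the derivation of `f ≈ g`. Among the ring axioms only commutativity of the product
-- needs the quotient property of `∂`.
∂-cong : ∀ k {f g} → f ≈ g → ∂ k f ≈ ∂ k g
∂-cong k ≈-refl = ≈-refl
∂-cong k (≈-sym p) = ≈-sym (∂-cong k p)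
∂-cong k (≈-trans p q) = ≈-trans (∂-cong k p) (∂-cong k q)
∂-cong k (+-cong p q) = +-cong (∂-cong k p) (∂-cong k q)
∂-cong k (*-cong p q) = +-cong (*-cong (∂-cong k p) q) (*-cong (rename-cong _ p) (∂-cong k q))
∂-cong k (-‿cong p) = -‿cong (∂-cong k p)
∂-cong k (+-assoc f g h) = +-assoc _ _ _
∂-cong k (+-comm f g) = +-comm _ _
∂-cong k (+-identityˡ f) = +-identityˡ _
∂-cong k (-‿inverseˡ f) = -‿inverseˡ _
∂-cong k (*-assoc f g h) =
  solve 7 (λ a b c d e f g → (a :* b :+ c :* d) :* e :+ (c :* f) :* g := a :* (b :* e) :+ c :* (d :* e :+ f :* g)) ≈-refl
    (∂ k f) g (swapVars k f) (∂ k g) h (swapVars k g) (∂ k h)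
∂-cong k (*-comm f g) = ∂-*-comm k f g
∂-cong k (*-identityˡ f) =
  solve 2 (λ f a → :con 0ℚ :* f :+ :con 1ℚ :* a := a) ≈-refl f (∂ k f)
∂-cong k (distribˡ f g h) =
  solve 6 (λ a g h f b c → a :* (g :+ h) :+ f :* (b :+ c) := (a :* g :+ f :* b) :+ (a :* h :+ f :* c)) ≈-refl
    (∂ k f) g h (swapVars k f) (∂ k g) (∂ k h)
∂-cong k (con-+ p q) = ≈-sym (+-identityˡ _)
∂-cong k (con-* p q) = solve 2 (λ p q → :con 0ℚ := :con 0ℚ :* q :+ p :* :con 0ℚ) ≈-refl (con p) (con q)

-- Linear operators and symmetric factors

record Linear (φ : Poly → Poly) : Set where
  field
    congruent   : ∀ {f g} → f ≈ g → φ f ≈ φ g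
    additive    : ∀ f g → φ (f + g) ≈ φ f + φ g
    homogeneous : ∀ c f → φ (con c * f) ≈ con c * φ f

  preserves-0 : φ 0ᴾ ≈ 0ᴾ
  preserves-0 = ≈-trans (congruent (≈-sym (P.zeroˡ 0ᴾ)))
    (≈-trans (homogeneous 0ℚ 0ᴾ) (P.zeroˡ _))

open Linear

∂-linear : ∀ k → Linear (∂ k)
∂-linear k = record
  { congruent   = ∂-cong k
  ; additive    = λ _ _ → ≈-refl
  ; homogeneous = λ c f → solve 3 (λ f c a → :con 0ℚ :* f :+ c :* a := c :* a) ≈-refl f (con c) (∂ k f)
  }

*ˡ-linear : ∀ h → Linear (h *_)
*ˡ-linear h = record
  { congruent   = *-congˡ
  ; additive    = distribˡ h
  ; homogeneous = λ c f → solve 3 (λ h c f → h :* (c :* f) := c :* (h :* f)) ≈-refl h (con c) f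
  }

*ʳ-linear : ∀ h → Linear (_* h)
*ʳ-linear h = record
  { congruent   = *-congʳ
  ; additive    = P.distribʳ h
  ; homogeneous = λ c f → *-assoc (con c) f h
  }

id-linear : Linear id
id-linear = record { congruent = id ; additive = λ _ _ → ≈-refl ; homogeneous = λ _ _ → ≈-refl }

∘-linear : ∀ {φ ψ} → Linear φ → Linear ψ → Linear (φ ∘ ψ)
∘-linear L M = record
  { congruent   = congruent L ∘ congruent M
  ; additive    = λ f g → ≈-trans (congruent L (additive M f g)) (additive L _ _)
  ; homogeneous = λ c f → ≈-trans (congruent L (homogeneous M c f)) (homogeneous L c _)
  }

-- T k = ∂_1 ∂_2 ⋯ ∂_k
T : ℕ → Poly → Poly
T zero    f = f
T (suc k) f = T k (∂ k f)

T-linear : ∀ k → Linear (T k)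
T-linear zero    = id-linear
T-linear (suc k) = ∘-linear (T-linear k) (∂-linear k)

-- The second component follows from the first because x_{k+1} - x_{k+2} is
-- not a zero divisor, but carrying it along is easier.
Symmetric : ℕ → Poly → Set
Symmetric k f = swapVars k f ≈ f × ∂ k f ≈ 0ᴾ

Symmetric-1 : ∀ k → Symmetric k 1ᴾ
Symmetric-1 k = ≈-refl , ≈-refl

Symmetric-+ : ∀ k {f g} → Symmetric k f → Symmetric k g → Symmetric k (f + g)
Symmetric-+ k (sf , df) (sg , dg) = +-cong sf sg , ≈-trans (+-cong df dg) (+-identityˡ _)

Symmetric-* : ∀ k {f g} → Symmetric k f → Symmetric k g → Symmetric k (f * g)
Symmetric-* k {f} {g} (sf , df) (sg , dg) = *-cong sf sg ,
  ≈-trans (+-cong (*-congʳ df) (*-congˡ dg))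
    (solve 2 (λ g f → :con 0ℚ :* g :+ f :* :con 0ℚ := :con 0ℚ) ≈-refl g (swapVars k f))

Symmetric-≈ : ∀ k {f g} → f ≈ g → Symmetric k f → Symmetric k g
Symmetric-≈ k p (sf , df) =
  ≈-trans (rename-cong _ (≈-sym p)) (≈-trans sf p) , ≈-trans (∂-cong k (≈-sym p)) df

∂-Symmetric-* : ∀ k {f} g → Symmetric k f → ∂ k (f * g) ≈ f * ∂ k g
∂-Symmetric-* k {f} g (sf , df) = ≈-trans (+-cong (*-congʳ df) (*-congʳ sf))
  (solve 3 (λ g f d → :con 0ℚ :* g :+ f :* d := f :* d) ≈-refl g f (∂ k g))

T-Symmetric-* : ∀ k {f} g → (∀ j → j ℕ.< k → Symmetric j f) → T k (f * g) ≈ f * T k g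
T-Symmetric-* zero    g sym = ≈-refl
T-Symmetric-* (suc k) g sym = ≈-trans
  (congruent (T-linear k) (∂-Symmetric-* k g (sym k ℕ.≤-refl)))
  (T-Symmetric-* k (∂ k g) (λ j j<k → sym j (ℕ.m<n⇒m<1+n j<k)))

-- Elementary symmetric polynomials

-- `choose`, and with it `e`, splits off the first variable, while `∂ k` acts at the end of x_1,
-- ..., x_{k+1}; this recursion splits off the last one.
ε : ℕ → ℕ → Poly
ε zero    n       = 1ᴾ
ε (suc p) zero    = 0ᴾ
ε (suc p) (suc n) = ε (suc p) n + var n * ε p n

module _ where
  private
    es : ℕ → List Poly → Poly
    es p xs = ∑ (map ∏ (choose p xs))

    ∑-++ : ∀ xs ys → ∑ (xs ++ ys) ≈ ∑ xs + ∑ ys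
    ∑-++ []       ys = ≈-sym (+-identityˡ _)
    ∑-++ (x ∷ xs) ys = ≈-trans (+-cong ≈-refl (∑-++ xs ys)) (≈-sym (+-assoc _ _ _))

    ∑-∏-∷ : ∀ x xss → ∑ (map ∏ (map (x ∷_) xss)) ≈ x * ∑ (map ∏ xss)
    ∑-∏-∷ x []         = ≈-sym (P.zeroʳ x)
    ∑-∏-∷ x (xs ∷ xss) = ≈-trans (+-cong ≈-refl (∑-∏-∷ x xss)) (≈-sym (distribˡ _ _ _))

    es-zero : ∀ xs → es 0 xs ≈ 1ᴾ
    es-zero xs = P.+-identityʳ 1ᴾ

    es-∷ : ∀ p x xs → es (suc p) (x ∷ xs) ≈ x * es p xs + es (suc p) xs
    es-∷ p x xs = ≈-trans
      (≡⇒≈ (cong ∑ (List.map-++ ∏ (map (x ∷_) (choose p xs)) (choose (suc p) xs))))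
      (≈-trans (∑-++ (map ∏ (map (x ∷_) (choose p xs))) _) (+-cong (∑-∏-∷ x (choose p xs)) ≈-refl))

    es-∷ʳ : ∀ p xs y → es (suc p) (xs ∷ʳ y) ≈ es (suc p) xs + y * es p xs
    es-∷ʳ zero [] y = ≈-trans (es-∷ 0 y []) (+-comm _ _)
    es-∷ʳ (suc p) [] y = ≈-trans (es-∷ (suc p) y []) (+-comm _ _)
    es-∷ʳ zero (x ∷ xs) y = begin
      es 1 (x ∷ xs ∷ʳ y)               ≈⟨ es-∷ 0 x (xs ∷ʳ y) ⟩
      x * es 0 xs + es 1 (xs ∷ʳ y)     ≈⟨ +-cong ≈-refl (es-∷ʳ 0 xs y) ⟩
      x * es 0 xs + (es 1 xs + y * es 0 xs) ≈⟨ +-assoc _ _ _ ⟨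
      (x * es 0 xs + es 1 xs) + y * es 0 xs ≈⟨ +-cong (es-∷ 0 x xs) ≈-refl ⟨
      es 1 (x ∷ xs) + y * es 0 xs ∎
      where open ≈-Reasoning
    es-∷ʳ (suc p) (x ∷ xs) y = begin
      es (2 ℕ.+ p) (x ∷ xs ∷ʳ y)                       ≈⟨ es-∷ (suc p) x (xs ∷ʳ y) ⟩
      x * es (suc p) (xs ∷ʳ y) + es (2 ℕ.+ p) (xs ∷ʳ y) ≈⟨ +-cong (*-congˡ (es-∷ʳ p xs y)) (es-∷ʳ (suc p) xs y) ⟩
      x * (a + y * b) + (c + y * a)                    ≈⟨ solve 5 (λ x y a b c → x :* (a :+ y :* b) :+ (c :+ y :* a) := (x :* a :+ c) :+ y :* (x :* b :+ a)) ≈-refl x y a b c ⟩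
      (x * a + c) + y * (x * b + a)                    ≈⟨ +-cong (es-∷ (suc p) x xs) (*-congˡ (es-∷ p x xs)) ⟨
      es (2 ℕ.+ p) (x ∷ xs) + y * es (suc p) (x ∷ xs)  ∎
      where open ≈-Reasoning
            a = es (suc p) xs
            b = es p xs
            c = es (2 ℕ.+ p) xs

  e≈ε : ∀ p n → e p n ≈ ε p n
  e≈ε zero    n       = es-zero (map var (upTo n))
  e≈ε (suc p) zero    = ≈-refl
  e≈ε (suc p) (suc n) = begin
    es (suc p) (map var (upTo (suc n)))       ≡⟨ cong (es (suc p) ∘ map var) (List.upTo-∷ʳ n) ⟨
    es (suc p) (map var (upTo n ∷ʳ n))        ≡⟨ cong (es (suc p)) (List.map-++ var (upTo n) (n ∷ [])) ⟩
    es (suc p) (map var (upTo n) ∷ʳ var n)    ≈⟨ es-∷ʳ p (map var (upTo n)) (var n) ⟩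
    e (suc p) n + var n * e p n               ≈⟨ +-cong (e≈ε (suc p) n) (*-congˡ (e≈ε p n)) ⟩
    ε (suc p) n + var n * ε p n               ∎
    where open ≈-Reasoning

ε-vanishes : ∀ {p n} → n ℕ.< p → ε p n ≈ 0ᴾ
ε-vanishes {suc p} {zero}  _         = ≈-refl
ε-vanishes {suc p} {suc n} (s≤s n<p) =
  ≈-trans (+-cong (ε-vanishes (ℕ.m<n⇒m<1+n n<p)) (*-congˡ (ε-vanishes n<p)))
    (≈-trans (+-identityˡ _) (P.zeroʳ _))

ε-top : ∀ n → ε (suc n) (suc n) ≈ var n * ε n n
ε-top n = ≈-trans (+-cong (ε-vanishes (ℕ.n<1+n n)) ≈-refl) (+-identityˡ _)

Symmetric-var : ∀ {k j} → j ≢ k → j ≢ suc k → Symmetric k (var j)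
Symmetric-var j≢k j≢1+k = ≡⇒≈ (swap-var-≢ j≢k j≢1+k) , ≡⇒≈ (∂-var-≢ j≢k j≢1+k)

Symmetric-x+x : ∀ k → Symmetric k (var k + var (suc k))
Symmetric-x+x k rewrite swap-var-left k | swap-var-right k | ∂-var-left k | ∂-var-right k =
  +-comm _ _ , P.-‿inverseʳ 1ᴾ

Symmetric-x*x : ∀ k → Symmetric k (var k * var (suc k))
Symmetric-x*x k rewrite swap-var-left k | swap-var-right k | ∂-var-left k | ∂-var-right k =
  *-comm _ _ , solve 1 (λ y → :con 1ℚ :* y :+ y :* (:- :con 1ℚ) := :con 0ℚ) ≈-refl (var (suc k))

ε-Symmetric-≤ : ∀ k p n → n ℕ.≤ k → Symmetric k (ε p n)
ε-Symmetric-≤ k zero    n       n≤k = Symmetric-1 k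
ε-Symmetric-≤ k (suc p) zero    n≤k = ≈-refl , ≈-refl
ε-Symmetric-≤ k (suc p) (suc n) n<k = Symmetric-+ k (ε-Symmetric-≤ k (suc p) n n≤k)
  (Symmetric-* k (Symmetric-var (ℕ.<⇒≢ n<k) (ℕ.<⇒≢ (ℕ.m<n⇒m<1+n n<k))) (ε-Symmetric-≤ k p n n≤k))
  where n≤k = ℕ.<⇒≤ n<k

-- With the two exchanged variables grouped, e_p(x_1...x_{k+2}) is e_p + (x_{k+1} + x_{k+2}) e_{p-1}
-- + x_{k+1} x_{k+2} e_{p-2}, all in x_1...x_k.
ε-Symmetric-+2 : ∀ k p → Symmetric k (ε p (2 ℕ.+ k))
ε-Symmetric-+2 k zero = Symmetric-1 k
ε-Symmetric-+2 k (suc zero) = Symmetric-≈ k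
  (solve 3 (λ a x y → a :+ (x :+ y) := (a :+ x :* :con 1ℚ) :+ y :* :con 1ℚ) ≈-refl (ε 1 k) (var k) (var (suc k)))
  (Symmetric-+ k (ε-Symmetric-≤ k 1 k ℕ.≤-refl) (Symmetric-x+x k))
ε-Symmetric-+2 k (suc (suc p)) = Symmetric-≈ k
  (solve 5 (λ a b c x y → (a :+ (x :+ y) :* b) :+ (x :* y) :* c := (a :+ x :* b) :+ y :* (b :+ x :* c)) ≈-refl
    (ε (suc (suc p)) k) (ε (suc p) k) (ε p k) (var k) (var (suc k)))
  (Symmetric-+ k
    (Symmetric-+ k (low (suc (suc p))) (Symmetric-* k (Symmetric-x+x k) (low (suc p))))
    (Symmetric-* k (Symmetric-x*x k) (low p)))
  where low = λ p → ε-Symmetric-≤ k p k ℕ.≤-refl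

ε-Symmetric-> : ∀ k p n → suc k ℕ.< n → Symmetric k (ε p n)
ε-Symmetric-> k zero    n       _         = Symmetric-1 k
ε-Symmetric-> k (suc p) (suc n) (s≤s 1+k≤n) with ℕ.m≤n⇒m<n∨m≡n 1+k≤n
... | inj₂ refl  = ε-Symmetric-+2 k (suc p)
... | inj₁ 1+k<n = Symmetric-+ k (ε-Symmetric-> k (suc p) n 1+k<n)
  (Symmetric-* k
    (Symmetric-var (λ n≡k → ℕ.<⇒≢ (ℕ.<-trans (ℕ.n<1+n k) 1+k<n) (sym n≡k)) (λ n≡1+k → ℕ.<⇒≢ 1+k<n (sym n≡1+k)))
    (ε-Symmetric-> k p n 1+k<n))

-- In e_{p+1}(x_1...x_k) + x_{k+1} e_p(x_1...x_k) only the explicit x_{k+1} is not symmetric in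
-- x_{k+1}, x_{k+2}, and its divided difference is 1.
∂-ε : ∀ k p → ∂ k (ε (suc p) (suc k)) ≈ ε p k
∂-ε k p rewrite ∂-var-left k = ≈-trans
  (+-cong (proj₂ (ε-Symmetric-≤ k (suc p) k ℕ.≤-refl))
    (+-cong ≈-refl (*-congˡ (proj₂ (ε-Symmetric-≤ k p k ℕ.≤-refl)))))
  (solve 2 (λ a b → :con 0ℚ :+ (:con 1ℚ :* a :+ b :* :con 0ℚ) := a) ≈-refl (ε p k) _)

∂-ε-* : ∀ k p {f} → Symmetric k f → ∂ k (ε (suc p) (suc k) * f) ≈ ε p k * f
∂-ε-* k p {f} sf = begin
  ∂ k (ε (suc p) (suc k) * f) ≈⟨ ∂-cong k (*-comm (ε (suc p) (suc k)) f) ⟩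
  ∂ k (f * ε (suc p) (suc k)) ≈⟨ ∂-Symmetric-* k _ sf ⟩
  f * ∂ k (ε (suc p) (suc k)) ≈⟨ *-congˡ (∂-ε k p) ⟩
  f * ε p k                   ≈⟨ *-comm f _ ⟩
  ε p k * f                   ∎
  where open ≈-Reasoning

∂-ε₀-* : ∀ k {f} → Symmetric k f → ∂ k (1ᴾ * f) ≈ 0ᴾ
∂-ε₀-* k sf = proj₂ (Symmetric-* k (Symmetric-1 k) sf)

-- e_{i+1}(x_1…x_k) e_j(x_1…x_k) is exchanged for e_i(x_1…x_k) e_{j+1}(x_1…x_k)
-- because both expressions for x_{k+1} e_i e_j coming from
-- e_{p+1}(x_1…x_{k+1}) = e_{p+1}(x_1…x_k) + x_{k+1} e_p(x_1…x_k) agree.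
straighten : ∀ (Φ : Poly → Set) → (∀ {f g} → f ≈ g → Φ f → Φ g) →
  (∀ {f g} → Φ f → Φ g → Φ (f + g)) → (∀ c {f} → Φ f → Φ (con c * f)) →
  ∀ k p q → (∀ r s → r ℕ.+ s ≡ p ℕ.+ q → Φ (ε r k * ε s (suc k))) → Φ (ε p k * ε q k)
straighten Φ Φ-≈ Φ-+ Φ-con k zero    q base = Φ-≈ (*-comm _ _) (base q 0 (ℕ.+-identityʳ q))
straighten Φ Φ-≈ Φ-+ Φ-con k (suc i) j base = Φ-≈
  (≈-sym (solve 5 (λ eᵢ eⱼ eᵢ₊₁ eⱼ₊₁ x → eᵢ₊₁ :* eⱼ :=
      eᵢ :* eⱼ₊₁ :+ (:con (ℚ.- 1ℚ) :* (eᵢ :* (eⱼ₊₁ :+ x :* eⱼ)) :+ eⱼ :* (eᵢ₊₁ :+ x :* eᵢ)))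
    ≈-refl (ε i k) (ε j k) (ε (suc i) k) (ε (suc j) k) (var k)))
  (Φ-+ (straighten Φ Φ-≈ Φ-+ Φ-con k i (suc j) (λ r s eq → base r s (trans eq (ℕ.+-suc i j))))
    (Φ-+ (Φ-con (ℚ.- 1ℚ) (base i (suc j) (ℕ.+-suc i j)))
      (base j (suc i) (ℕ.+-comm j (suc i)))))

-- Spans of standard elementary monomials on a window

-- The SEM whose indices at m, m+1, …, m + length as - 1 are listed by as from
-- the last to the first.
sem : ℕ → List ℕ → Poly
sem m []       = 1ᴾ
sem m (p ∷ as) = ε p (m ℕ.+ length as) * sem m as

-- The factor with the most variables has m + length as - 1 of them, hence the bound `suc k` rather
-- than `k`.
sem-Symmetric : ∀ k m as → m ℕ.+ length as ℕ.≤ suc k → Symmetric k (sem m as)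
sem-Symmetric k m []       _ = Symmetric-1 k
sem-Symmetric k m (p ∷ as) le = Symmetric-* k
  (ε-Symmetric-≤ k p _ (ℕ.≤-pred le′)) (sem-Symmetric k m as (ℕ.<⇒≤ le′))
  where le′ = subst (ℕ._≤ suc k) (ℕ.+-suc m (length as)) le

-- Repeated lists and zero coefficients are allowed, so that linear operators act term by term;
-- `normalise` cleans up at the end. The predicate `Q` carries the length of the window and the
-- degree.
data Span (m : ℕ) (Q : List ℕ → Set) (f : Poly) : Set where
  term : ∀ c as → Q as → f ≈ con c * sem m as → Span m Q f
  null : f ≈ 0ᴾ → Span m Q f
  plus : ∀ {g h} → Span m Q g → Span m Q h → f ≈ g + h → Span m Q f

module _ {m : ℕ} {Q : List ℕ → Set} where

  Span-≈ : ∀ {f g} → f ≈ g → Span m Q f → Span m Q g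
  Span-≈ p (term c as q f≈) = term c as q (≈-trans (≈-sym p) f≈)
  Span-≈ p (null f≈)        = null (≈-trans (≈-sym p) f≈)
  Span-≈ p (plus s t f≈)    = plus s t (≈-trans (≈-sym p) f≈)

  Span-+ : ∀ {f g} → Span m Q f → Span m Q g → Span m Q (f + g)
  Span-+ s t = plus s t ≈-refl

  Span-con-* : ∀ c {f} → Span m Q f → Span m Q (con c * f)
  Span-con-* c (term d as q f≈) = term (c ℚ.* d) as q
    (≈-trans (*-congˡ f≈) (≈-trans (≈-sym (*-assoc _ _ _)) (*-congʳ (≈-sym (con-* c d)))))
  Span-con-* c (null f≈)     = null (≈-trans (*-congˡ f≈) (P.zeroʳ _))
  Span-con-* c (plus s t f≈) = plus (Span-con-* c s) (Span-con-* c t)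
    (≈-trans (*-congˡ f≈) (distribˡ _ _ _))

  Span-sem : ∀ as → Q as → Span m Q (sem m as)
  Span-sem as q = term 1ℚ as q (≈-sym (*-identityˡ _))

Span-map : ∀ {m Q m′ Q′ φ} → Linear φ → (∀ as → Q as → Span m′ Q′ (φ (sem m as))) →
  ∀ {f} → Span m Q f → Span m′ Q′ (φ f)
Span-map L φ-sem (term c as q f≈) =
  Span-≈ (≈-sym (≈-trans (congruent L f≈) (homogeneous L c _))) (Span-con-* c (φ-sem as q))
Span-map L φ-sem (null f≈)     = null (≈-trans (congruent L f≈) (preserves-0 L))
Span-map L φ-sem (plus s t f≈) = plus (Span-map L φ-sem s) (Span-map L φ-sem t)
  (≈-trans (congruent L f≈) (additive L _ _))

Span-weaken : ∀ {m Q Q′} → (∀ as → Q as → Q′ as) → ∀ {f} → Span m Q f → Span m Q′ f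
Span-weaken Q⇒Q′ = Span-map id-linear (λ as q → Span-sem as (Q⇒Q′ as q))

-- This turns degree bookkeeping into vanishing: if the degree equation in `Q` has no solution, the
-- polynomial is zero.
Span-empty : ∀ {m Q} → (∀ as → ¬ Q as) → ∀ {f} → Span m Q f → f ≈ 0ᴾ
Span-empty ¬Q (term c as q _) = ⊥-elim (¬Q as q)
Span-empty ¬Q (null f≈)       = f≈
Span-empty ¬Q (plus s t f≈)   =
  ≈-trans f≈ (≈-trans (+-cong (Span-empty ¬Q s) (Span-empty ¬Q t)) (+-identityˡ _))

Span-bounded : ∀ {m Q f} → Span m Q f → Σ[ d ∈ ℕ ] Span m (λ as → Q as × sum as ℕ.≤ d) f
Span-bounded (term c as q f≈) = sum as , term c as (q , ℕ.≤-refl) f≈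
Span-bounded (null f≈)        = 0 , null f≈
Span-bounded (plus s t f≈) with Span-bounded s | Span-bounded t
... | d , s′ | d′ , t′ = d ℕ.⊔ d′ , plus
  (Span-weaken (λ as → map₂ (λ le → ℕ.≤-trans le (ℕ.m≤m⊔n d d′))) s′)
  (Span-weaken (λ as → map₂ (λ le → ℕ.≤-trans le (ℕ.m≤n⊔m d d′))) t′) f≈

-- The product is rewritten before `φ` is applied, which is why `straighten` takes an arbitrary
-- predicate: here it is membership of the image under `φ` in a span.
Span-straighten : ∀ {m Q φ} → Linear φ → ∀ k p q →
  (∀ r s → r ℕ.+ s ≡ p ℕ.+ q → Span m Q (φ (ε r k * ε s (suc k)))) →
  Span m Q (φ (ε p k * ε q k))
Span-straighten {m} {Q} {φ} L = straighten (Span m Q ∘ φ)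
  (λ p → Span-≈ (congruent L p))
  (λ s t → Span-≈ (≈-sym (additive L _ _)) (Span-+ s t))
  (λ c s → Span-≈ (≈-sym (homogeneous L c _)) (Span-con-* c s))

-- Divided differences of standard elementary monomials

-- Only the factor in k+1 variables is not symmetric in x_{k+1}, x_{k+2}. It drops to k variables,
-- where it meets the factor already there; straightening puts one of the two back at k+1 variables,
-- so the window keeps its length.
∂-sem : ∀ k as → suc k ℕ.< length as → Span 0 (λ bs → length bs ≡ length as) (∂ k (sem 0 as))
∂-sem k (p ∷ as) (s≤s k<) with ℕ.m≤n⇒m<n∨m≡n k<
... | inj₁ 1+k< = Span-≈ (≈-sym (∂-Symmetric-* k (sem 0 as) (ε-Symmetric-> k p _ 1+k<)))
  (Span-map (*ˡ-linear (ε p (length as)))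
    (λ bs eq → Span-≈ (*-congʳ (≡⇒≈ (cong (ε p) eq))) (Span-sem (p ∷ bs) (cong suc eq)))
    (∂-sem k as 1+k<))
∂-sem k (zero  ∷ q ∷ as) _ | inj₂ refl = null (∂-ε₀-* k (sem-Symmetric k 0 (q ∷ as) ℕ.≤-refl))
∂-sem k (suc p ∷ q ∷ as) _ | inj₂ refl = Span-≈
  (≈-sym (≈-trans (∂-ε-* k p (sem-Symmetric k 0 (q ∷ as) ℕ.≤-refl)) (≈-sym (*-assoc _ _ _))))
  (Span-straighten (*ʳ-linear (sem 0 as)) k p q (λ r s _ → Span-≈
    (solve 3 (λ r s x → s :* (r :* x) := (r :* s) :* x) ≈-refl (ε r k) (ε s (suc k)) (sem 0 as))
    (Span-sem (s ∷ r ∷ as) refl)))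

-- Each ∂_j takes e_r(x_1...x_j) to e_{r-1}(x_1...x_{j-1}). If r = k the chain ends in 1; if r < k
-- it reaches ∂ of the constant e_0; if r > k the polynomial is already zero.
T-ε : ∀ k r m → Span m (λ bs → bs ≡ [] × r ≡ k) (T k (ε r k))
T-ε zero    zero    m = Span-sem [] (refl , refl)
T-ε zero    (suc r) m = null ≈-refl
T-ε (suc k) zero    m = null (preserves-0 (T-linear k))
T-ε (suc k) (suc r) m = Span-≈ (≈-sym (congruent (T-linear k) (∂-ε k r)))
  (Span-weaken (λ as → map₂ (cong suc)) (T-ε k r m))

T-ε-top : ∀ k → T k (ε k k) ≈ 1ᴾ
T-ε-top zero    = ≈-refl
T-ε-top (suc k) = ≈-trans (congruent (T-linear k) (∂-ε k k)) (T-ε-top k)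

T-suc : ∀ m r p as → let k = m ℕ.+ length as in
  T (suc k) (ε (suc r) (suc k) * sem m (p ∷ as)) ≈ T k (ε r k * sem m (p ∷ as))
T-suc m r p as = congruent (T-linear k)
  (∂-ε-* k r (sem-Symmetric k m (p ∷ as) (ℕ.≤-reflexive (ℕ.+-suc m (length as)))))
  where k = m ℕ.+ length as

-- For a nonempty list, the first divided difference lowers the leading factor to as many variables
-- as the head of the list. Straightening these two leaves one factor with one variable more, which
-- is symmetric for the remaining operators and becomes the head of the new list; the other one
-- leads the same problem for the tail. The shift uses r = k, but the induction meets every r. The
-- equation of sums says that `T k` lowers the degree by k.
T-sem : ∀ m as r → let k = m ℕ.+ length as in
  Span (suc m) (λ bs → length bs ≡ length as × sum bs ℕ.+ k ≡ r ℕ.+ sum as) (T k (ε r k * sem m as))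
T-sem m [] r = Span-≈ (congruent (T-linear (m ℕ.+ 0)) (≈-sym (P.*-identityʳ _)))
  (Span-weaken (λ { .[] (refl , r≡k) → refl , trans (sym r≡k) (sym (ℕ.+-identityʳ r)) }) (T-ε (m ℕ.+ 0) r (suc m)))
T-sem m (p ∷ as) r rewrite ℕ.+-suc m (length as) = step r
  where
  k = m ℕ.+ length as
  Q : ℕ → List ℕ → Set
  Q r bs = length bs ≡ suc (length as) × sum bs ℕ.+ suc k ≡ r ℕ.+ (p ℕ.+ sum as)
  φ = λ g → T k (g * sem m as)
  φ-linear = ∘-linear (T-linear k) (*ʳ-linear (sem m as))

  sum-rule : ∀ {r s r′ b} → r′ ℕ.+ s ≡ r ℕ.+ p → b ℕ.+ k ≡ r′ ℕ.+ sum as →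
    (s ℕ.+ b) ℕ.+ suc k ≡ suc r ℕ.+ (p ℕ.+ sum as)
  sum-rule {r} {s} {r′} {b} eq₁ eq₂ = begin
    (s ℕ.+ b) ℕ.+ suc k       ≡⟨ ℕ.+-suc (s ℕ.+ b) k ⟩
    suc ((s ℕ.+ b) ℕ.+ k)     ≡⟨ cong suc (ℕ.+-assoc s b k) ⟩
    suc (s ℕ.+ (b ℕ.+ k))     ≡⟨ cong (λ z → suc (s ℕ.+ z)) eq₂ ⟩
    suc (s ℕ.+ (r′ ℕ.+ sum as)) ≡⟨ cong suc (ℕ.+-assoc s r′ (sum as)) ⟨
    suc ((s ℕ.+ r′) ℕ.+ sum as) ≡⟨ cong (λ z → suc (z ℕ.+ sum as)) (trans (ℕ.+-comm s r′) eq₁) ⟩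
    suc ((r ℕ.+ p) ℕ.+ sum as) ≡⟨ cong suc (ℕ.+-assoc r p (sum as)) ⟩
    suc r ℕ.+ (p ℕ.+ sum as)  ∎
    where open ≡-Reasoning

  step : ∀ r → Span (suc m) (Q r) (T (suc k) (ε r (suc k) * sem m (p ∷ as)))
  step zero = null (≈-trans
    (congruent (T-linear k) (∂-ε₀-* k (sem-Symmetric k m (p ∷ as) (ℕ.≤-reflexive (ℕ.+-suc m (length as))))))
    (preserves-0 (T-linear k)))
  step (suc r) = Span-≈
    (≈-sym (≈-trans (T-suc m r p as) (congruent (T-linear k) (≈-sym (*-assoc _ _ _)))))
    (Span-straighten φ-linear k r p (λ r′ s eq → Span-≈
      (≈-sym (≈-trans
        (congruent (T-linear k)
          (solve 3 (λ r s x → (r :* s) :* x := s :* (r :* x)) ≈-refl (ε r′ k) (ε s (suc k)) (sem m as)))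
        (T-Symmetric-* k _ (λ j j<k → ε-Symmetric-> j s (suc k) (s≤s j<k)))))
      (Span-map (*ˡ-linear (ε s (suc k)))
        (λ bs (len , tot) → Span-≈
          (*-congʳ (≡⇒≈ (cong (λ l → ε s (suc m ℕ.+ l)) len)))
          (Span-sem (s ∷ bs) (cong suc len , sum-rule {r} {s} {r′} {sum bs} eq tot)))
        (T-sem m as r′))))

T-sem-vanishes : ∀ m as r → let k = m ℕ.+ length as in
  r ℕ.+ sum as ℕ.< k → T k (ε r k * sem m as) ≈ 0ᴾ
T-sem-vanishes m as r lt = Span-empty
  (λ bs (_ , tot) → ℕ.<⇒≱ lt (subst (k ℕ.≤_) tot (ℕ.m≤n+m k (sum bs))))
  (T-sem m as r)
  where k = m ℕ.+ length as

-- As e_{k+1}(x_1...x_k) = 0, straightening e_k(x_1...x_k) e_p(x_1...x_k) for p > 0 gives just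
-- e_p(x_1...x_{k+1}) e_k(x_1...x_k) - e_{k+1}(x_1...x_{k+1}) e_{p-1}(x_1...x_k). The first term
-- continues the induction. In the second the symmetric factor leaves `T k`, and what stays inside
-- has degree below m ≤ k and dies.
T-sem-shift : ∀ m as → let k = m ℕ.+ length as in
  sum as ℕ.< m → T k (ε k k * sem m as) ≈ sem (suc m) as
T-sem-shift m [] _ = ≈-trans (congruent (T-linear (m ℕ.+ 0)) (P.*-identityʳ _)) (T-ε-top (m ℕ.+ 0))
T-sem-shift m (p ∷ as) lt rewrite ℕ.+-suc m (length as) =
  ≈-trans (T-suc m k p as) (step p lt)
  where
  open ≈-Reasoning
  k = m ℕ.+ length as
  S = sem m as
  symmetric : ∀ p j → j ℕ.< k → Symmetric j (ε p (suc k))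
  symmetric p j j<k = ε-Symmetric-> j p (suc k) (s≤s j<k)
  step : ∀ p → p ℕ.+ sum as ℕ.< m → T k (ε k k * (ε p k * S)) ≈ ε p (suc k) * sem (suc m) as
  step zero lt = begin
    T k (ε k k * (1ᴾ * S)) ≈⟨ congruent (T-linear k) (*-congˡ (*-identityˡ S)) ⟩
    T k (ε k k * S)        ≈⟨ T-sem-shift m as lt ⟩
    sem (suc m) as         ≈⟨ *-identityˡ _ ⟨
    1ᴾ * sem (suc m) as    ∎
  step (suc p) lt = begin
    T k (ε k k * (ε (suc p) k * S))
      ≈⟨ congruent (T-linear k) (solve 5
           (λ a b c x s → a :* (b :* s) := (b :+ x :* c) :* (a :* s) :+ (:con (ℚ.- 1ℚ)) :* ((x :* a) :* (c :* s)))
           ≈-refl (ε k k) (ε (suc p) k) (ε p k) (var k) S) ⟩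
    T k (ε (suc p) (suc k) * (ε k k * S) + con (ℚ.- 1ℚ) * ((var k * ε k k) * (ε p k * S)))
      ≈⟨ congruent (T-linear k) (+-cong ≈-refl (*-congˡ (*-congʳ (ε-top k)))) ⟨
    T k (ε (suc p) (suc k) * (ε k k * S) + con (ℚ.- 1ℚ) * (ε (suc k) (suc k) * (ε p k * S)))
      ≈⟨ ≈-trans (additive (T-linear k) _ _) (+-cong ≈-refl (homogeneous (T-linear k) (ℚ.- 1ℚ) _)) ⟩
    T k (ε (suc p) (suc k) * (ε k k * S)) + con (ℚ.- 1ℚ) * T k (ε (suc k) (suc k) * (ε p k * S))
      ≈⟨ +-cong (T-Symmetric-* k _ (symmetric (suc p))) (*-congˡ (T-Symmetric-* k _ (symmetric (suc k)))) ⟩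
    ε (suc p) (suc k) * T k (ε k k * S) + con (ℚ.- 1ℚ) * (ε (suc k) (suc k) * T k (ε p k * S))
      ≈⟨ +-cong (*-congˡ (T-sem-shift m as (ℕ.≤-<-trans (ℕ.m≤n+m _ (suc p)) lt)))
           (*-congˡ (*-congˡ (T-sem-vanishes m as p (ℕ.<-≤-trans (ℕ.<-trans (ℕ.n<1+n _) lt) (ℕ.m≤m+n m _))))) ⟩
    ε (suc p) (suc k) * sem (suc m) as + con (ℚ.- 1ℚ) * (ε (suc k) (suc k) * 0ᴾ)
      ≈⟨ solve 2 (λ a b → a :+ :con (ℚ.- 1ℚ) :* (b :* :con 0ℚ) := a) ≈-refl (ε (suc p) (suc k) * sem (suc m) as) (ε (suc k) (suc k)) ⟩
    ε (suc p) (suc k) * sem (suc m) as ∎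

-- The staircase as a standard elementary monomial

∏-upTo-suc : ∀ (f : ℕ → Poly) n → ∏ (map f (upTo (suc n))) ≈ ∏ (map f (upTo n)) * f n
∏-upTo-suc f n = ≈-trans
  (≡⇒≈ (cong ∏ (trans (cong (map f) (sym (List.upTo-∷ʳ n))) (List.map-++ f (upTo n) (n ∷ [])))))
  (∏-∷ʳ (map f (upTo n)))
  where
  ∏-∷ʳ : ∀ fs → ∏ (fs ∷ʳ f n) ≈ ∏ fs * f n
  ∏-∷ʳ []       = *-comm _ _
  ∏-∷ʳ (g ∷ fs) = ≈-trans (*-congˡ (∏-∷ʳ fs)) (≈-sym (*-assoc _ _ _))

-- `ε n n` is x_1 ⋯ x_n, and multiplying by it raises every exponent by one.
staircase-suc : ∀ n → staircase (suc n) ≈ ε n n * staircase n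
staircase-suc zero    = ≈-sym (*-identityˡ _)
staircase-suc (suc n) = ≈-trans (go (suc n) ℕ.≤-refl) (*-congˡ drop-last)
  where
  open ≈-Reasoning
  f g : ℕ → Poly
  f k = var k ^ (suc n ℕ.∸ k)
  g k = var k ^ (n ℕ.∸ k)
  fg : ∀ k → k ℕ.≤ n → f k ≡ var k * g k
  fg k k≤n rewrite ℕ.+-∸-assoc 1 k≤n = refl
  go : ∀ j → j ℕ.≤ suc n → ∏ (map f (upTo j)) ≈ ε j j * ∏ (map g (upTo j))
  go zero    _   = ≈-sym (*-identityˡ _)
  go (suc j) j<n = begin
    ∏ (map f (upTo (suc j)))                        ≈⟨ ∏-upTo-suc f j ⟩
    ∏ (map f (upTo j)) * f j                        ≈⟨ *-cong (go j (ℕ.<⇒≤ j<n)) (≡⇒≈ (fg j (ℕ.≤-pred j<n))) ⟩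
    (ε j j * ∏ (map g (upTo j))) * (var j * g j)    ≈⟨ solve 4 (λ a b c d → (a :* b) :* (c :* d) := (c :* a) :* (b :* d)) ≈-refl _ _ _ _ ⟩
    (var j * ε j j) * (∏ (map g (upTo j)) * g j)    ≈⟨ *-cong (ε-top j) (∏-upTo-suc g j) ⟨
    ε (suc j) (suc j) * ∏ (map g (upTo (suc j)))    ∎
  -- `staircase (suc n)` has one factor fewer; the surplus factor is x_{n+1} to the power 0.
  drop-last : ∏ (map g (upTo (suc n))) ≈ ∏ (map g (upTo n))
  drop-last = ≈-trans (∏-upTo-suc g n)
    (≈-trans (*-congˡ (≡⇒≈ (cong (var n ^_) (ℕ.n∸n≡0 n)))) (P.*-identityʳ _))

staircase≈sem : ∀ n → staircase n ≈ sem 0 (downFrom n)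
staircase≈sem zero    = ≈-refl
staircase≈sem (suc n) = ≈-trans (staircase-suc n)
  (*-cong (≡⇒≈ (cong (ε n) (sym (List.length-downFrom n)))) (staircase≈sem n))

-- Expansions in normal form

-- The start of the window is an argument, so that one list of coefficients can be read at every
-- shift.
⟦_⟧ : List (List ℕ × ℚ) → ℕ → Poly
⟦ ts ⟧ m = ∑ (map (λ t → con (proj₂ t) * sem m (proj₁ t)) ts)

T-⟦⟧-shift : ∀ m n ts → All (λ t → length (proj₁ t) ≡ n × sum (proj₁ t) ℕ.< m) ts →
  T (m ℕ.+ n) (ε (m ℕ.+ n) (m ℕ.+ n) * ⟦ ts ⟧ m) ≈ ⟦ ts ⟧ (suc m)
T-⟦⟧-shift m n = go
  where
  L = ∘-linear (T-linear (m ℕ.+ n)) (*ˡ-linear (ε (m ℕ.+ n) (m ℕ.+ n)))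
  go : ∀ ts → All (λ t → length (proj₁ t) ≡ n × sum (proj₁ t) ℕ.< m) ts →
    T (m ℕ.+ n) (ε (m ℕ.+ n) (m ℕ.+ n) * ⟦ ts ⟧ m) ≈ ⟦ ts ⟧ (suc m)
  go []              []                    = preserves-0 L
  go ((as , c) ∷ ts) ((refl , lt) ∷ rest) = ≈-trans (additive L _ _)
    (+-cong (≈-trans (homogeneous L c _) (*-congˡ (T-sem-shift m as lt))) (go ts rest))

-- Merging equal lists and dropping zero sums produces the distinct indices and nonzero coefficients
-- that the theorem asks for.
insert : List ℕ → ℚ → List (List ℕ × ℚ) → List (List ℕ × ℚ)
insert as c [] with c ℚ.≟ 0ℚ
... | yes _ = []
... | no  _ = (as , c) ∷ []
insert as c ((bs , d) ∷ ts) with List.≡-dec ℕ._≟_ as bs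
... | no  _ = (bs , d) ∷ insert as c ts
... | yes _ with c ℚ.+ d ℚ.≟ 0ℚ
...   | yes _ = ts
...   | no  _ = (bs , c ℚ.+ d) ∷ ts

insert-⟦⟧ : ∀ m as c ts → ⟦ insert as c ts ⟧ m ≈ con c * sem m as + ⟦ ts ⟧ m
insert-⟦⟧ m as c [] with c ℚ.≟ 0ℚ
... | yes refl = solve 1 (λ x → :con 0ℚ := :con 0ℚ :* x :+ :con 0ℚ) ≈-refl (sem m as)
... | no  _    = ≈-refl
insert-⟦⟧ m as c ((bs , d) ∷ ts) with List.≡-dec ℕ._≟_ as bs
... | no  _ = ≈-trans (+-cong ≈-refl (insert-⟦⟧ m as c ts))
  (solve 3 (λ x y z → x :+ (y :+ z) := y :+ (x :+ z)) ≈-refl _ _ _)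
... | yes refl with c ℚ.+ d ℚ.≟ 0ℚ | con-+ c d
...   | yes eq | c+d = begin
  ⟦ ts ⟧ m                                     ≈⟨ solve 2 (λ x y → y := :con 0ℚ :* x :+ y) ≈-refl (sem m as) _ ⟩
  0ᴾ * sem m as + ⟦ ts ⟧ m                     ≈⟨ +-cong (*-congʳ (≈-trans (≡⇒≈ (cong con (sym eq))) c+d)) ≈-refl ⟩
  (con c + con d) * sem m as + ⟦ ts ⟧ m        ≈⟨ solve 4 (λ c d x y → (c :+ d) :* x :+ y := c :* x :+ (d :* x :+ y)) ≈-refl (con c) (con d) (sem m as) _ ⟩
  con c * sem m as + (con d * sem m as + ⟦ ts ⟧ m) ∎
  where open ≈-Reasoning
...   | no  _  | c+d = ≈-trans (+-cong (*-congʳ c+d) ≈-refl)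
  (solve 4 (λ c d x y → (c :+ d) :* x :+ y := c :* x :+ (d :* x :+ y)) ≈-refl (con c) (con d) (sem m as) _)

insert-keys : ∀ {Q : List ℕ → Set} as c ts → Q as → All (Q ∘ proj₁) ts → All (Q ∘ proj₁) (insert as c ts)
insert-keys as c [] q [] with c ℚ.≟ 0ℚ
... | yes _ = []
... | no  _ = q ∷ []
insert-keys as c ((bs , d) ∷ ts) q (r ∷ rs) with List.≡-dec ℕ._≟_ as bs
... | no  _ = r ∷ insert-keys as c ts q rs
... | yes _ with c ℚ.+ d ℚ.≟ 0ℚ
...   | yes _ = rs
...   | no  _ = r ∷ rs

record Normal (ts : List (List ℕ × ℚ)) : Set where
  constructor _,_
  field
    distinct : AllPairs (λ t u → proj₁ t ≢ proj₁ u) ts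
    nonzero  : All (λ t → proj₂ t ≢ 0ℚ) ts

insert-Normal : ∀ as c {ts} → Normal ts → Normal (insert as c ts)
insert-Normal as c {[]} _ with c ℚ.≟ 0ℚ
... | yes _  = [] , []
... | no c≢0 = ([] ∷ []) , (c≢0 ∷ [])
insert-Normal as c {(bs , d) ∷ ts} ((≢s ∷ ds) , (d≢0 ∷ nz)) with List.≡-dec ℕ._≟_ as bs
... | no as≢bs = let ds′ , nz′ = insert-Normal as c {ts} (ds , nz) in
  (insert-keys as c ts (as≢bs ∘ sym) ≢s ∷ ds′) , (d≢0 ∷ nz′)
... | yes _ with c ℚ.+ d ℚ.≟ 0ℚ
...   | yes _ = ds , nz
...   | no c+d≢0 = (≢s ∷ ds) , (c+d≢0 ∷ nz)

normalise : ∀ {m Q f} → Span m Q f →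
  Σ[ ts ∈ List (List ℕ × ℚ) ] Normal ts × All (Q ∘ proj₁) ts × f ≈ ⟦ ts ⟧ m
normalise {m} {Q} s = let ts , N , A , eq = go s [] ([] , []) [] in
  ts , N , A , ≈-trans (≈-sym (P.+-identityʳ _)) eq
  where
  go : ∀ {f} → Span m Q f → ∀ us → Normal us → All (Q ∘ proj₁) us →
    Σ[ ts ∈ List (List ℕ × ℚ) ] Normal ts × All (Q ∘ proj₁) ts × f + ⟦ us ⟧ m ≈ ⟦ ts ⟧ m
  go (term c as q f≈) us N A = insert as c us , insert-Normal as c N , insert-keys as c us q A ,
    ≈-trans (+-cong f≈ ≈-refl) (≈-sym (insert-⟦⟧ m as c us))
  go (null f≈) us N A = us , N , A , ≈-trans (+-cong f≈ ≈-refl) (+-identityˡ _)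
  go (plus s t f≈) us N A =
    let vs , N′ , A′ , eq′ = go t us N A
        ts , N″ , A″ , eq″ = go s vs N′ A′
    in ts , N″ , A″ , ≈-trans (+-cong f≈ ≈-refl) (≈-trans (+-assoc _ _ _) (≈-trans (+-cong ≈-refl eq′) eq″))

-- Transpositions and inverse permutations

module _ {A : Set} (_≟_ : DecidableEquality A) where

  transposition-left : ∀ a b → transposition _≟_ a b a ≡ b
  transposition-left a b with a ≟ a
  ... | yes _  = refl
  ... | no a≢a = ⊥-elim (a≢a refl)

  transposition-right : ∀ a b → transposition _≟_ a b b ≡ a
  transposition-right a b with b ≟ a
  ... | yes b≡a = b≡a
  ... | no _ with b ≟ b
  ...   | yes _  = refl
  ...   | no b≢b = ⊥-elim (b≢b refl)

  transposition-other : ∀ {a b c} → c ≢ a → c ≢ b → transposition _≟_ a b c ≡ c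
  transposition-other c≢a c≢b = transposition-fixes _≟_ (⊥-elim ∘ c≢a) (⊥-elim ∘ c≢b)

_⁻_ : Sℤ → ℤ → ℤ
u ⁻ i = Inverse.from (Sℤ.perm u) i

⁻-left : ∀ u i → u ⁻ (u ⟨$⟩ i) ≡ i
⁻-left u = Inverse.strictlyInverseʳ (Sℤ.perm u)

⁻-right : ∀ u i → u ⟨$⟩ (u ⁻ i) ≡ i
⁻-right u = Inverse.strictlyInverseˡ (Sℤ.perm u)

⟨$⟩-injective : ∀ u {i j} → u ⟨$⟩ i ≡ u ⟨$⟩ j → i ≡ j
⟨$⟩-injective u {i} {j} eq = trans (sym (⁻-left u i)) (trans (cong (u ⁻_) eq) (⁻-left u j))

⁻-injective : ∀ u {i j} → u ⁻ i ≡ u ⁻ j → i ≡ j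
⁻-injective u {i} {j} eq = trans (sym (⁻-right u i)) (trans (cong (u ⟨$⟩_) eq) (⁻-right u j))

⁻-cong : ∀ {u v} → u ≈ˢ v → ∀ i → u ⁻ i ≡ v ⁻ i
⁻-cong {u} {v} u≈v i = ⟨$⟩-injective v
  (trans (sym (u≈v (u ⁻ i))) (trans (⁻-right u i) (sym (⁻-right v i))))

-- Inversions

𝟙 : {A : Set} → Dec A → ℕ
𝟙 d = if does d then 1 else 0

𝟙-yes : {A : Set} (d : Dec A) → A → 𝟙 d ≡ 1
𝟙-yes d a = cong (if_then 1 else 0) (dec-true d a)

𝟙-no : {A : Set} (d : Dec A) → ¬ A → 𝟙 d ≡ 0
𝟙-no d ¬a = cong (if_then 1 else 0) (dec-false d ¬a)

𝟙-≤ : {A : Set} (d : Dec A) {n : ℕ} → (A → 1 ℕ.≤ n) → 𝟙 d ℕ.≤ n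
𝟙-≤ (yes a) f = f a
𝟙-≤ (no _)  f = z≤n

𝟙⇒ : {A : Set} (d : Dec A) → 1 ℕ.≤ 𝟙 d → A
𝟙⇒ (yes a) _ = a

∑< : (ℕ → ℕ) → ℕ → ℕ
∑< f zero    = 0
∑< f (suc n) = f n ℕ.+ ∑< f n

∑<-mono : ∀ {f g} n → (∀ a → a ℕ.< n → f a ℕ.≤ g a) → ∑< f n ℕ.≤ ∑< g n
∑<-mono zero    f≤g = z≤n
∑<-mono (suc n) f≤g = ℕ.+-mono-≤ (f≤g n ℕ.≤-refl) (∑<-mono n (λ a a<n → f≤g a (ℕ.m<n⇒m<1+n a<n)))

∑<-strict : ∀ {f g} n b → b ℕ.< n → (∀ a → a ℕ.< n → f a ℕ.≤ g a) → f b ℕ.< g b → ∑< f n ℕ.< ∑< g n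
∑<-strict (suc n) b b<1+n f≤g f<g with ℕ.m≤n⇒m<n∨m≡n (ℕ.≤-pred b<1+n)
... | inj₁ b<n  = ℕ.+-mono-≤-< (f≤g n ℕ.≤-refl) (∑<-strict n b b<n (λ a a<n → f≤g a (ℕ.m<n⇒m<1+n a<n)) f<g)
... | inj₂ refl = ℕ.+-mono-<-≤ f<g (∑<-mono n (λ a a<n → f≤g a (ℕ.m<n⇒m<1+n a<n)))

∑<-+ : ∀ f g n → ∑< (λ a → f a ℕ.+ g a) n ≡ ∑< f n ℕ.+ ∑< g n
∑<-+ f g zero    = refl
∑<-+ f g (suc n) = trans (cong (f n ℕ.+ g n ℕ.+_) (∑<-+ f g n)) (+-interchange (f n) (g n) (∑< f n) (∑< g n))
  where open CommutativeSemigroupProperties ℕ.+-commutativeSemigroup renaming (interchange to +-interchange)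

∑<-≤0 : ∀ {f} n → (∀ a → a ℕ.< n → f a ℕ.≤ 0) → ∑< f n ℕ.≤ 0
∑<-≤0 zero    f≤0 = z≤n
∑<-≤0 (suc n) f≤0 = ℕ.+-mono-≤ (f≤0 n ℕ.≤-refl) (∑<-≤0 n (λ a a<n → f≤0 a (ℕ.m<n⇒m<1+n a<n)))

∑<-≤1 : ∀ {f} n → (∀ a → f a ℕ.≤ 1) → (∀ a b → a ≢ b → 1 ℕ.≤ f a → 1 ℕ.≤ f b → ⊥) → ∑< f n ℕ.≤ 1
∑<-≤1         zero    f≤1 uniq = z≤n
∑<-≤1 {f = f} (suc n) f≤1 uniq with 1 ℕ.≤? f n
... | yes 1≤fn = ℕ.+-mono-≤ (f≤1 n) (∑<-≤0 n (λ a a<n →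
        ℕ.≮⇒≥ (λ 0<fa → uniq a n (ℕ.<⇒≢ a<n) 0<fa 1≤fn)))
... | no  1≰fn = ℕ.+-mono-≤ (ℕ.≮⇒≥ 1≰fn) (∑<-≤1 n f≤1 uniq)

inversions : (ℕ → ℤ) → ℕ → ℕ
inversions g = ∑< (λ b → ∑< (λ a → 𝟙 (g b ℤ.<? g a)) b)

inversions-mono : ∀ {g h} n → (∀ a b → a ℕ.< b → b ℕ.< n → g b ℤ.< g a → h b ℤ.< h a) →
  inversions g n ℕ.≤ inversions h n
inversions-mono {g} {h} n imp = ∑<-mono n (λ b b<n → ∑<-mono b (λ a a<b → 𝟙-≤ (g b ℤ.<? g a)
  (λ lt → ℕ.≤-reflexive (sym (𝟙-yes (h b ℤ.<? h a) (imp a b a<b b<n lt))))))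

inversions-strict : ∀ {g h} n a₀ b₀ → a₀ ℕ.< b₀ → b₀ ℕ.< n →
  (∀ a b → a ℕ.< b → b ℕ.< n → g b ℤ.< g a → h b ℤ.< h a) →
  ¬ g b₀ ℤ.< g a₀ → h b₀ ℤ.< h a₀ → inversions g n ℕ.< inversions h n
inversions-strict {g} {h} n a₀ b₀ a₀<b₀ b₀<n imp g≮ h< = ∑<-strict n b₀ b₀<n
  (λ b b<n → ∑<-mono b (pointwise b b<n))
  (∑<-strict b₀ a₀ a₀<b₀ (pointwise b₀ b₀<n)
    (subst₂ ℕ._<_ (sym (𝟙-no (g b₀ ℤ.<? g a₀) g≮)) (sym (𝟙-yes (h b₀ ℤ.<? h a₀) h<)) (s≤s z≤n)))
  where
  pointwise : ∀ b → b ℕ.< n → ∀ a → a ℕ.< b → 𝟙 (g b ℤ.<? g a) ℕ.≤ 𝟙 (h b ℤ.<? h a)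
  pointwise b b<n a a<b = 𝟙-≤ (g b ℤ.<? g a)
    (λ lt → ℕ.≤-reflexive (sym (𝟙-yes (h b ℤ.<? h a) (imp a b a<b b<n lt))))

swap : ℤ → ℤ → ℤ
swap i = transposition ℤ._≟_ i (sucℤ i)

swap-left : ∀ i → swap i i ≡ sucℤ i
swap-left i = transposition-left ℤ._≟_ i (sucℤ i)

swap-right : ∀ i → swap i (sucℤ i) ≡ i
swap-right i = transposition-right ℤ._≟_ i (sucℤ i)

swap-other : ∀ {i j} → j ≢ i → j ≢ sucℤ i → swap i j ≡ j
swap-other = transposition-other ℤ._≟_

i<1+i : ∀ i → i ℤ.< sucℤ i
i<1+i i = ℤ.≤-<-trans (ℤ.≤-reflexive (sym (ℤ.+-identityˡ i))) (ℤ.+-monoˡ-< i (ℤ.+<+ (s≤s z≤n)))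

-- No integer lies strictly between i and i+1, so exchanging them alters the order of that pair
-- only.
swap-reflects-< : ∀ i x y → swap i x ℤ.< swap i y → x ℤ.< y ⊎ (y ≡ i × x ≡ sucℤ i)
swap-reflects-< i x y lt = cases (x ℤ.≟ i) (x ℤ.≟ sucℤ i) (y ℤ.≟ i) (y ℤ.≟ sucℤ i)
  where
  cases : Dec (x ≡ i) → Dec (x ≡ sucℤ i) → Dec (y ≡ i) → Dec (y ≡ sucℤ i) → x ℤ.< y ⊎ (y ≡ i × x ≡ sucℤ i)
  cases (yes refl) _ (yes refl) _ = ⊥-elim (ℤ.<-irrefl refl lt)
  cases (yes refl) _ (no _) (yes refl) = inj₁ (i<1+i i)
  cases (yes refl) _ (no y≢i) (no y≢1+i) = inj₁ (ℤ.<-trans (i<1+i i)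
        (subst₂ ℤ._<_ (swap-left i) (swap-other y≢i y≢1+i) lt))
  cases (no _) (yes refl) (yes refl) _ = inj₂ (refl , refl)
  cases (no _) (yes refl) (no _) (yes refl) = ⊥-elim (ℤ.<-irrefl refl lt)
  cases (no _) (yes refl) (no y≢i) (no y≢1+i) = inj₁ (ℤ.≤∧≢⇒<
        (ℤ.i<j⇒suc[i]≤j (subst₂ ℤ._<_ (swap-right i) (swap-other y≢i y≢1+i) lt)) (y≢1+i ∘ sym))
  cases (no x≢i) (no x≢1+i) (yes refl) _ = inj₁ (ℤ.≰⇒> (λ i≤x → ℤ.<⇒≱
        (subst₂ ℤ._<_ (swap-other x≢i x≢1+i) (swap-left i) lt)
        (ℤ.i<j⇒suc[i]≤j (ℤ.≤∧≢⇒< i≤x (x≢i ∘ sym)))))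
  cases (no x≢i) (no x≢1+i) (no _) (yes refl) = inj₁ (ℤ.<-trans
        (subst₂ ℤ._<_ (swap-other x≢i x≢1+i) (swap-right i) lt) (i<1+i i))
  cases (no x≢i) (no x≢1+i) (no y≢i) (no y≢1+i) = inj₁
        (subst₂ ℤ._<_ (swap-other x≢i x≢1+i) (swap-other y≢i y≢1+i) lt)

-- A new inversion needs g a = i and g b = i+1. By injectivity at most one pair does this; `hit` is
-- its indicator.
inversions-swap-≤ : ∀ (g : ℕ → ℤ) → (∀ {a b} → g a ≡ g b → a ≡ b) → ∀ i n →
  inversions (swap i ∘ g) n ℕ.≤ suc (inversions g n)
inversions-swap-≤ g g-inj i n = begin
  inversions (swap i ∘ g) n
    ≤⟨ ∑<-mono n (λ b _ → ∑<-mono b (λ a _ → pointwise a b)) ⟩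
  ∑< (λ b → ∑< (λ a → hit a b ℕ.+ 𝟙 (g b ℤ.<? g a)) b) n
    ≤⟨ ∑<-mono n (λ b _ → ℕ.≤-reflexive (∑<-+ (λ a → hit a b) _ b)) ⟩
  ∑< (λ b → hits b ℕ.+ ∑< (λ a → 𝟙 (g b ℤ.<? g a)) b) n
    ≡⟨ ∑<-+ hits _ n ⟩
  ∑< hits n ℕ.+ inversions g n
    ≤⟨ ℕ.+-monoˡ-≤ (inversions g n) (∑<-≤1 n hits≤1 hits-unique) ⟩
  suc (inversions g n) ∎
  where
  open ℕ.≤-Reasoning
  hit : ℕ → ℕ → ℕ
  hit a b = 𝟙 ((g a ℤ.≟ i) ×-dec (g b ℤ.≟ sucℤ i))
  hits : ℕ → ℕ
  hits b = ∑< (λ a → hit a b) b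

  hit⇒ : ∀ a b → 1 ℕ.≤ hit a b → g a ≡ i × g b ≡ sucℤ i
  hit⇒ a b = 𝟙⇒ ((g a ℤ.≟ i) ×-dec (g b ℤ.≟ sucℤ i))

  hits⇒ : ∀ b m → 1 ℕ.≤ ∑< (λ a → hit a b) m → g b ≡ sucℤ i
  hits⇒ b (suc m) le with 1 ℕ.≤? hit m b
  ... | yes 1≤ = proj₂ (hit⇒ m b 1≤)
  ... | no  1≰ = hits⇒ b m (ℕ.≤-trans le (ℕ.+-monoˡ-≤ _ (ℕ.≮⇒≥ 1≰)))

  hits≤1 : ∀ b → hits b ℕ.≤ 1
  hits≤1 b = ∑<-≤1 b (λ a → 𝟙-≤ ((g a ℤ.≟ i) ×-dec (g b ℤ.≟ sucℤ i)) (λ _ → ℕ.≤-refl))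
    (λ a a′ a≢a′ h h′ → a≢a′ (g-inj (trans (proj₁ (hit⇒ a b h)) (sym (proj₁ (hit⇒ a′ b h′))))))

  hits-unique : ∀ b b′ → b ≢ b′ → 1 ℕ.≤ hits b → 1 ℕ.≤ hits b′ → ⊥
  hits-unique b b′ b≢b′ h h′ = b≢b′ (g-inj (trans (hits⇒ b b h) (sym (hits⇒ b′ b′ h′))))

  pointwise : ∀ a b → 𝟙 (swap i (g b) ℤ.<? swap i (g a)) ℕ.≤ hit a b ℕ.+ 𝟙 (g b ℤ.<? g a)
  pointwise a b = 𝟙-≤ (swap i (g b) ℤ.<? swap i (g a)) (λ lt → case (swap-reflects-< i (g b) (g a) lt))
    where
    case : _ → 1 ℕ.≤ hit a b ℕ.+ 𝟙 (g b ℤ.<? g a)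
    case (inj₁ lt) = ℕ.≤-trans (ℕ.≤-reflexive (sym (𝟙-yes (g b ℤ.<? g a) lt))) (ℕ.m≤n+m _ (hit a b))
    case (inj₂ p)  = ℕ.≤-trans (ℕ.≤-reflexive (sym (𝟙-yes ((g a ℤ.≟ i) ×-dec (g b ℤ.≟ sucℤ i)) p)))
      (ℕ.m≤m+n (hit a b) _)

-- Coxeter length

-- Counting the inversions of u⁻¹ rather than of u makes right multiplication by s_i
-- act on values, where it affects only the pair with values i and i+1.
ℓ : ℕ → Sℤ → ℕ
ℓ n u = inversions (λ a → u ⁻ +[1+ a ]) n

ℓ-cong : ∀ n {u v} → u ≈ˢ v → ℓ n u ≡ ℓ n v
ℓ-cong n {u} {v} u≈v = ℕ.≤-antisym
  (inversions-mono n (λ a b _ _ → subst₂ ℤ._<_ (eq _) (eq _)))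
  (inversions-mono n (λ a b _ _ → subst₂ ℤ._<_ (sym (eq _)) (sym (eq _))))
  where eq = ⁻-cong {u} {v} u≈v

ℓ-id : ∀ n → ℓ n idˢ ≡ 0
ℓ-id n = ℕ.n≤0⇒n≡0 (∑<-≤0 n (λ b _ → ∑<-≤0 b (λ a a<b →
  𝟙-≤ (+[1+ b ] ℤ.<? +[1+ a ]) (λ lt → ⊥-elim (ℤ.<-asym lt (ℤ.+<+ (s≤s a<b)))))))

ℓ-∙-s : ∀ n u i → ℓ n (u ∙ s i) ℕ.≤ suc (ℓ n u)
ℓ-∙-s n u i = inversions-swap-≤ (λ a → u ⁻ +[1+ a ]) (ℤ.+[1+-injective ∘ ⁻-injective u) i n

-- The letters range over all of ℤ because minimality in `IsCoxeterLength` does: every s_i adds at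
-- most one inversion among the values 1, ..., n, even when it moves integers outside that range.
ℓ-∙-word : ∀ n u word → ℓ n (u ∙ ∏s word) ℕ.≤ length word ℕ.+ ℓ n u
ℓ-∙-word n u []         = ℕ.≤-reflexive (ℓ-cong n {u ∙ idˢ} {u} (λ _ → refl))
ℓ-∙-word n u (i ∷ word) = begin
  ℓ n (u ∙ (s i ∙ ∏s word))        ≡⟨ ℓ-cong n {u ∙ (s i ∙ ∏s word)} {(u ∙ s i) ∙ ∏s word} (λ _ → refl) ⟩
  ℓ n ((u ∙ s i) ∙ ∏s word)        ≤⟨ ℓ-∙-word n (u ∙ s i) word ⟩
  length word ℕ.+ ℓ n (u ∙ s i)    ≤⟨ ℕ.+-monoʳ-≤ (length word) (ℓ-∙-s n u i) ⟩
  length word ℕ.+ suc (ℓ n u)      ≡⟨ ℕ.+-suc (length word) (ℓ n u) ⟩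
  suc (length word) ℕ.+ ℓ n u      ∎
  where open ℕ.≤-Reasoning

-- Permutations of {1, ..., n}, descents and sorting

record Supported (n : ℕ) (u : Sℤ) : Set where
  field
    low  : u ∈S∞
    high : ∀ k → n ℕ.≤ k → u ⟨$⟩ +[1+ k ] ≡ +[1+ k ]

open Supported

Supported-id : ∀ n → Supported n idˢ
Supported-id n = record { low = λ _ _ → refl ; high = λ _ _ → refl }

Supported-cong : ∀ {n u v} → u ≈ˢ v → Supported n u → Supported n v
Supported-cong u≈v S = record
  { low  = λ i i≤0 → trans (sym (u≈v i)) (low S i i≤0)
  ; high = λ k n≤k → trans (sym (u≈v _)) (high S k n≤k) }

Supported-∙ : ∀ {n} u v → Supported n u → Supported n v → Supported n (u ∙ v)
Supported-∙ u v S S′ = record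
  { low  = λ i i≤0 → trans (cong (u ⟨$⟩_) (low S′ i i≤0)) (low S i i≤0)
  ; high = λ k n≤k → trans (cong (u ⟨$⟩_) (high S′ k n≤k)) (high S k n≤k) }

s-fixes-≤0 : ∀ k i → i ℤ.≤ 0ℤ → s +[1+ k ] ⟨$⟩ i ≡ i
s-fixes-≤0 k i i≤0 = swap-other
  (λ { refl → ℤ.<⇒≱ (ℤ.+<+ (s≤s z≤n)) i≤0 }) (λ { refl → ℤ.<⇒≱ (ℤ.+<+ (s≤s z≤n)) i≤0 })

s-fixes : ∀ {k j} → j ≢ k → j ≢ suc k → s +[1+ k ] ⟨$⟩ +[1+ j ] ≡ +[1+ j ]
s-fixes j≢k j≢1+k = swap-other (j≢k ∘ ℤ.+[1+-injective) (j≢1+k ∘ ℤ.+[1+-injective)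

s-left : ∀ k → s +[1+ k ] ⟨$⟩ +[1+ k ] ≡ +[1+ suc k ]
s-left k = swap-left +[1+ k ]

s-right : ∀ k → s +[1+ k ] ⟨$⟩ +[1+ suc k ] ≡ +[1+ k ]
s-right k = swap-right +[1+ k ]

s-involutive : ∀ i j → s i ⟨$⟩ (s i ⟨$⟩ j) ≡ j
s-involutive i = transposition-involutive ℤ._≟_ i (sucℤ i)

Supported-s : ∀ {n} k → suc k ℕ.< n → Supported n (s +[1+ k ])
Supported-s {n} k 1+k<n = record
  { low  = s-fixes-≤0 k
  ; high = λ j n≤j → let 1+k<j = ℕ.<-≤-trans 1+k<n n≤j in
      s-fixes (λ { refl → ℕ.<-asym 1+k<j ℕ.≤-refl }) (λ { refl → ℕ.<-irrefl refl 1+k<j }) }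

≈ˢ-within : ∀ {n u v} → Supported n u → Supported n v →
  (∀ k → k ℕ.< n → u ⟨$⟩ +[1+ k ] ≡ v ⟨$⟩ +[1+ k ]) → u ≈ˢ v
≈ˢ-within {n} S S′ eq (+ zero) = trans (low S _ ℤ.≤-refl) (sym (low S′ _ ℤ.≤-refl))
≈ˢ-within {n} S S′ eq -[1+ i ] = trans (low S _ ℤ.-≤+) (sym (low S′ _ ℤ.-≤+))
≈ˢ-within {n} S S′ eq +[1+ k ] with k ℕ.<? n
... | yes k<n = eq k k<n
... | no  k≮n = trans (high S k (ℕ.≮⇒≥ k≮n)) (sym (high S′ k (ℕ.≮⇒≥ k≮n)))

-- A value outside 1, ..., n would be a fixed point of u, and by injectivity equal to the argument
-- k+1, which lies inside.
image : ∀ {n} u → Supported n u → ∀ {k} → k ℕ.< n → Σ[ j ∈ ℕ ] j ℕ.< n × u ⟨$⟩ +[1+ k ] ≡ +[1+ j ]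
image {n} u S {k} k<n = cases (u ⟨$⟩ +[1+ k ]) refl
  where
  cases : ∀ i → u ⟨$⟩ +[1+ k ] ≡ i → Σ[ j ∈ ℕ ] j ℕ.< n × u ⟨$⟩ +[1+ k ] ≡ +[1+ j ]
  moved : ∀ {i} → u ⟨$⟩ +[1+ k ] ≡ i → u ⟨$⟩ i ≡ i → +[1+ k ] ≡ i
  moved eq fixed = ⟨$⟩-injective u (trans eq (sym fixed))
  cases (+ zero) eq with () ← moved eq (low S _ ℤ.≤-refl)
  cases -[1+ i ] eq with () ← moved eq (low S _ ℤ.-≤+)
  cases +[1+ j ] eq with j ℕ.<? n
  ... | yes j<n = j , j<n , eq
  ... | no  j≮n = ⊥-elim (j≮n (subst (ℕ._< n)
          (ℤ.+[1+-injective (moved eq (high S j (ℕ.≮⇒≥ j≮n)))) k<n))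

Descent : ℕ → Sℤ → Set
Descent k u = u ⟨$⟩ +[1+ suc k ] ℤ.< u ⟨$⟩ +[1+ k ]

-- The values a₀+1 = u(k+2) and b₀+1 = u(k+1) form an inversion of the inverse of u that disappears.
-- A new inversion could only come from the same two values in the opposite order, which a₀ < b₀
-- excludes.
ℓ-descent : ∀ {n} u → Supported n u → ∀ {k} → suc k ℕ.< n → Descent k u → ℓ n (u ∙ s +[1+ k ]) ℕ.< ℓ n u
ℓ-descent {n} u S {k} 1+k<n desc
  with image u S (ℕ.<-trans (ℕ.n<1+n k) 1+k<n) | image u S 1+k<n
... | b₀ , b₀<n , u-k | a₀ , a₀<n , u-1+k = inversions-strict n a₀ b₀ a₀<b₀ b₀<n imp
        (λ lt → ℤ.<-asym lt (subst₂ ℤ._<_ (sym s-a₀) (sym s-b₀) (i<1+i +[1+ k ])))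
        (subst₂ ℤ._<_ (sym g-b₀) (sym g-a₀) (i<1+i +[1+ k ]))
  where
  g : ℕ → ℤ
  g a = u ⁻ +[1+ a ]
  a₀<b₀ : a₀ ℕ.< b₀
  a₀<b₀ = ℕ.≤-pred (ℤ.drop‿+<+ (subst₂ ℤ._<_ u-1+k u-k desc))
  g-b₀ : g b₀ ≡ +[1+ k ]
  g-b₀ = trans (cong (u ⁻_) (sym u-k)) (⁻-left u _)
  g-a₀ : g a₀ ≡ +[1+ suc k ]
  g-a₀ = trans (cong (u ⁻_) (sym u-1+k)) (⁻-left u _)
  s-b₀ : swap +[1+ k ] (g b₀) ≡ +[1+ suc k ]
  s-b₀ = trans (cong (swap +[1+ k ]) g-b₀) (swap-left +[1+ k ])
  s-a₀ : swap +[1+ k ] (g a₀) ≡ +[1+ k ]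
  s-a₀ = trans (cong (swap +[1+ k ]) g-a₀) (swap-right +[1+ k ])
  imp : ∀ a b → a ℕ.< b → b ℕ.< n → swap +[1+ k ] (g b) ℤ.< swap +[1+ k ] (g a) → g b ℤ.< g a
  imp a b a<b _ lt with swap-reflects-< +[1+ k ] (g b) (g a) lt
  ... | inj₁ lt′       = lt′
  ... | inj₂ (ga , gb) = ⊥-elim (ℕ.<-asym a₀<b₀ (subst₂ ℕ._<_
          (ℤ.+[1+-injective (⁻-injective u (trans ga (sym g-b₀))))
          (ℤ.+[1+-injective (⁻-injective u (trans gb (sym g-a₀)))) a<b))

-- Without descents the zero-based values `f` increase strictly within 0, ..., n-1. Counting steps
-- from the left end gives k ≤ f k, counting steps to the right end gives f k ≤ k.
increasing-id : ∀ {n} u → Supported n u → (∀ k → suc k ℕ.< n → ¬ Descent k u) → u ≈ˢ idˢ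
increasing-id {n} u S noDesc = ≈ˢ-within S (Supported-id n) (λ k k<n →
  trans (f-eq k<n) (cong +[1+_] (ℕ.≤-antisym (upper k<n) (lower k<n))))
  where
  f : ℕ → ℕ
  f k = ℕ.pred ∣ u ⟨$⟩ +[1+ k ] ∣
  f-eq : ∀ {k} → k ℕ.< n → u ⟨$⟩ +[1+ k ] ≡ +[1+ f k ]
  f-eq k<n with image u S k<n
  ... | j , _ , eq = trans eq (cong (λ i → +[1+ ℕ.pred ∣ i ∣ ]) (sym eq))
  f<n : ∀ {k} → k ℕ.< n → f k ℕ.< n
  f<n k<n with image u S k<n
  ... | j , j<n , eq = subst (ℕ._< n) (cong (λ i → ℕ.pred ∣ i ∣) (sym eq)) j<n
  f-step : ∀ {k} → suc k ℕ.< n → f k ℕ.< f (suc k)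
  f-step {k} 1+k<n with ℕ.<-cmp (f k) (f (suc k))
  ... | tri< lt _ _ = lt
  ... | tri≈ _ eq _ = ⊥-elim (ℕ.1+n≢n (ℤ.+[1+-injective (⟨$⟩-injective u
          (trans (f-eq 1+k<n) (trans (cong +[1+_] (sym eq)) (sym (f-eq (ℕ.<-trans (ℕ.n<1+n k) 1+k<n))))))))
  ... | tri> _ _ gt = ⊥-elim (noDesc k 1+k<n
          (subst₂ ℤ._<_ (sym (f-eq 1+k<n)) (sym (f-eq (ℕ.<-trans (ℕ.n<1+n k) 1+k<n))) (ℤ.+<+ (s≤s gt))))
  f-steps : ∀ j k → j ℕ.+ k ℕ.< n → j ℕ.+ f k ℕ.≤ f (j ℕ.+ k)
  f-steps zero    k _  = ℕ.≤-refl
  f-steps (suc j) k lt = ℕ.≤-trans (s≤s (f-steps j k (ℕ.<-trans (ℕ.n<1+n _) lt))) (f-step lt)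
  lower : ∀ {k} → k ℕ.< n → k ℕ.≤ f k
  lower {k} k<n = subst (λ l → k ℕ.≤ f l) (ℕ.+-identityʳ k) (ℕ.≤-trans (ℕ.m≤m+n k (f 0))
    (f-steps k 0 (subst (ℕ._< n) (sym (ℕ.+-identityʳ k)) k<n)))
  upper : ∀ {k} → k ℕ.< n → f k ℕ.≤ k
  upper {k} k<n = ℕ.≤-pred (ℕ.+-cancelˡ-≤ j (suc (f k)) (suc k) (begin
    j ℕ.+ suc (f k)   ≡⟨ ℕ.+-suc j (f k) ⟩
    suc (j ℕ.+ f k)   ≤⟨ s≤s (f-steps j k (ℕ.≤-reflexive total)) ⟩
    suc (f (j ℕ.+ k)) ≤⟨ f<n (ℕ.≤-reflexive total) ⟩
    n                 ≡⟨ total ⟨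
    suc (j ℕ.+ k)     ≡⟨ ℕ.+-suc j k ⟨
    j ℕ.+ suc k       ∎))
    where
    open ℕ.≤-Reasoning
    j = n ℕ.∸ suc k
    total : suc (j ℕ.+ k) ≡ n
    total = trans (sym (ℕ.+-suc j k)) (ℕ.m∸n+n≡m k<n)

find-descent : ∀ u n → (Σ[ k ∈ ℕ ] suc k ℕ.< n × Descent k u) ⊎ (∀ k → suc k ℕ.< n → ¬ Descent k u)
find-descent u zero = inj₂ (λ _ ())
find-descent u (suc n) with ℕ.anyUpTo? (λ k → u ⟨$⟩ +[1+ suc k ] ℤ.<? u ⟨$⟩ +[1+ k ]) n
... | yes (k , k<n , desc) = inj₁ (k , s≤s k<n , desc)
... | no  none             = inj₂ (λ k 1+k<1+n desc → none (k , ℕ.≤-pred 1+k<1+n , desc))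

-- Bubble sort: removing a descent lowers `ℓ n`, and only the identity has none. It yields reduced
-- words and, applied to `w₀ n ∙ u`, the way down from `w₀ n` to u.
sorting-induction : ∀ n (Q : Sℤ → Set) → (∀ u → u ≈ˢ idˢ → Q u) →
  (∀ k u → suc k ℕ.< n → Supported n u → Descent k u → Q (u ∙ s +[1+ k ]) → Q u) →
  ∀ u → Supported n u → Q u
sorting-induction n Q base step u S = go (suc (ℓ n u)) u S ℕ.≤-refl
  where
  go : ∀ bound u → Supported n u → ℓ n u ℕ.< bound → Q u
  go (suc bound) u S lt with find-descent u n
  ... | inj₂ none = base u (increasing-id u S none)
  ... | inj₁ (k , 1+k<n , desc) = step k u 1+k<n S desc
          (go bound (u ∙ s +[1+ k ]) (Supported-∙ u (s +[1+ k ]) S (Supported-s k 1+k<n))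
            (ℕ.<-≤-trans (ℓ-descent u S 1+k<n desc) (ℕ.≤-pred lt)))

∙-s-s : ∀ u i → (u ∙ s i) ∙ s i ≈ˢ u
∙-s-s u i j = cong (u ⟨$⟩_) (s-involutive i j)

∏s-∷ʳ : ∀ word i → ∏s (word ∷ʳ i) ≈ˢ ∏s word ∙ s i
∏s-∷ʳ []         i j = refl
∏s-∷ʳ (k ∷ word) i j = cong (s k ⟨$⟩_) (∏s-∷ʳ word i j)

reduced-word : ∀ {n} u → Supported n u → Σ[ word ∈ List ℤ ] ∏s word ≈ˢ u × length word ≡ ℓ n u
reduced-word {n} = sorting-induction n (λ u → Σ[ word ∈ List ℤ ] ∏s word ≈ˢ u × length word ≡ ℓ n u)
  (λ u u≈id → [] , (λ i → sym (u≈id i)) , sym (trans (ℓ-cong n {u} {idˢ} u≈id) (ℓ-id n)))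
  step
  where
  step : ∀ k u → suc k ℕ.< n → Supported n u → Descent k u →
    Σ[ word ∈ List ℤ ] ∏s word ≈ˢ u ∙ s +[1+ k ] × length word ≡ ℓ n (u ∙ s +[1+ k ]) →
    Σ[ word ∈ List ℤ ] ∏s word ≈ˢ u × length word ≡ ℓ n u
  step k u 1+k<n S desc (word , eq , len) = word ∷ʳ +[1+ k ]
    , (λ j → trans (∏s-∷ʳ word +[1+ k ] j) (trans (eq _) (∙-s-s u +[1+ k ] j)))
    , trans (List.length-++-comm word (+[1+ k ] ∷ [])) (trans (cong suc len) (ℕ.≤-antisym
        (ℓ-descent u S 1+k<n desc)
        (ℕ.≤-trans (ℕ.≤-reflexive (ℓ-cong n {u} {(u ∙ s +[1+ k ]) ∙ s +[1+ k ]} (λ j → sym (∙-s-s u +[1+ k ] j))))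
          (ℓ-∙-s n (u ∙ s +[1+ k ]) +[1+ k ]))))

ℓ-isCoxeterLength : ∀ {n} u → Supported n u → IsCoxeterLength u (ℓ n u)
ℓ-isCoxeterLength {n} u S = record
  { word    = proj₁ (reduced-word u S)
  ; product = proj₁ (proj₂ (reduced-word u S))
  ; size    = proj₂ (proj₂ (reduced-word u S))
  ; minimal = λ word eq → begin
      ℓ n u                       ≡⟨ ℓ-cong n {idˢ ∙ ∏s word} {u} eq ⟨
      ℓ n (idˢ ∙ ∏s word)         ≤⟨ ℓ-∙-word n idˢ word ⟩
      length word ℕ.+ ℓ n idˢ     ≡⟨ cong (length word ℕ.+_) (ℓ-id n) ⟩
      length word ℕ.+ 0           ≡⟨ ℕ.+-identityʳ _ ⟩
      length word                 ∎
  }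
  where open ℕ.≤-Reasoning

-- Schubert polynomials

-- A version of `IsSchubert` with the rank n fixed and descents in place of lengths, so that an
-- induction can replace `w₀ n` by `w₀ (suc n)`.
data Schubert (n : ℕ) (u : Sℤ) (f : Poly) : Set where
  top  : u ≈ˢ w₀ n → f ≈ staircase n → Schubert n u f
  down : ∀ k {v g} → suc k ℕ.< n → Schubert n v g → Descent k v →
         u ≈ˢ v ∙ s +[1+ k ] → f ≈ ∂ k g → Schubert n u f

Schubert-cong : ∀ {n u v f g} → u ≈ˢ v → f ≈ g → Schubert n u f → Schubert n v g
Schubert-cong u≈v f≈g (top eq f≈) = top (λ i → trans (sym (u≈v i)) (eq i)) (≈-trans (≈-sym f≈g) f≈)
Schubert-cong u≈v f≈g (down k 1+k<n P desc eq f≈) =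
  down k 1+k<n P desc (λ i → trans (sym (u≈v i)) (eq i)) (≈-trans (≈-sym f≈g) f≈)

w₀-inside : ∀ n k → k ℕ.< n → w₀ n ⟨$⟩ +[1+ k ] ≡ +[1+ n ℕ.∸ suc k ]
w₀-inside n k k<n = begin
  reversal n +[1+ k ]     ≡⟨ reversal-inside n +[1+ k ] (ℤ.+≤+ (s≤s z≤n) , ℤ.+≤+ k<n) ⟩
  + suc n ℤ.- +[1+ k ]    ≡⟨ ℤ.[+m]-[+n]≡m⊖n (suc n) (suc k) ⟩
  suc n ℤ.⊖ suc k         ≡⟨ ℤ.⊖-≥ (s≤s (ℕ.<⇒≤ k<n)) ⟩
  + (n ℕ.∸ k)             ≡⟨ cong +_ (ℕ.+-∸-assoc 1 k<n) ⟩
  +[1+ n ℕ.∸ suc k ]      ∎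
  where open ≡-Reasoning

Supported-w₀ : ∀ n → Supported n (w₀ n)
Supported-w₀ n = record
  { low  = λ i i≤0 → reversal-outside n i (λ (1≤i , _) → ℤ.<⇒≱ (ℤ.+<+ (s≤s z≤n)) (ℤ.≤-trans 1≤i i≤0))
  ; high = λ k n≤k → reversal-fixes n +[1+ k ] (s≤s n≤k) }

Schubert-Supported : ∀ {n u f} → Schubert n u f → Supported n u
Schubert-Supported {n} (top eq _) = Supported-cong (λ i → sym (eq i)) (Supported-w₀ n)
Schubert-Supported (down k {v} 1+k<n P _ eq _) = Supported-cong (λ i → sym (eq i))
  (Supported-∙ v (s +[1+ k ]) (Schubert-Supported P) (Supported-s k 1+k<n))

Schubert⇒IsSchubert : ∀ {n u f} → Schubert n u f → IsSchubert u f
Schubert⇒IsSchubert {n} (top eq f≈) = longest n eq f≈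
Schubert⇒IsSchubert {n} (down k {v} {g} 1+k<n P desc eq f≈) =
  descend k (Schubert⇒IsSchubert P) eq
    ( ℓ n (v ∙ s +[1+ k ]) , ℓ n v
    , ℓ-isCoxeterLength (v ∙ s +[1+ k ]) (Supported-∙ v (s +[1+ k ]) S (Supported-s k 1+k<n))
    , ℓ-isCoxeterLength v S , ℓ-descent v S 1+k<n desc )
    (≈-trans (*-congˡ f≈) (∂-isDividedDifference k g))
  where S = Schubert-Supported P

-- Left multiplication by w₀ turns descents into ascents. Writing u = w₀ x with x = w₀ u, each
-- descent sorted out of x is an ascent removed from w₀ x, and x = id corresponds to w₀. Read
-- backwards, sorting x is a descending path from w₀ to u.
Schubert-exists : ∀ {n} u → Supported n u →
  Σ[ f ∈ Poly ] Schubert n u f × Span 0 (λ as → length as ≡ n) f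
Schubert-exists {n} u S =
  let f , P , sp = sorting-induction n Q base step (w₀ n ∙ u) (Supported-∙ (w₀ n) u (Supported-w₀ n) S)
  in f , Schubert-cong (λ i → reversal-involutive n (u ⟨$⟩ i)) ≈-refl P , sp
  where
  Q : Sℤ → Set
  Q x = Σ[ f ∈ Poly ] Schubert n (w₀ n ∙ x) f × Span 0 (λ as → length as ≡ n) f
  base : ∀ x → x ≈ˢ idˢ → Q x
  base x x≈id = staircase n , top (λ i → cong (w₀ n ⟨$⟩_) (x≈id i)) ≈-refl
    , Span-≈ (≈-sym (staircase≈sem n)) (Span-sem (downFrom n) (List.length-downFrom n))
  step : ∀ k x → suc k ℕ.< n → Supported n x → Descent k x → Q (x ∙ s +[1+ k ]) → Q x
  step k x 1+k<n S desc (f , P , sp)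
    with image x S (ℕ.<-trans (ℕ.n<1+n k) 1+k<n) | image x S 1+k<n
  ... | b , b<n , x-k | a , a<n , x-1+k = ∂ k f
    , down k 1+k<n P
        (subst₂ ℤ._<_
          (sym (trans (cong (λ i → w₀ n ⟨$⟩ (x ⟨$⟩ i)) (s-right k)) (trans (cong (w₀ n ⟨$⟩_) x-k) (w₀-inside n b b<n))))
          (sym (trans (cong (λ i → w₀ n ⟨$⟩ (x ⟨$⟩ i)) (s-left k)) (trans (cong (w₀ n ⟨$⟩_) x-1+k) (w₀-inside n a a<n))))
          (ℤ.+<+ (s≤s (ℕ.∸-monoʳ-< (ℤ.drop‿+<+ (subst₂ ℤ._<_ x-1+k x-k desc)) b<n))))
        (λ i → sym (∙-s-s (w₀ n ∙ x) +[1+ k ] i)) ≈-refl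
    , Span-map (∂-linear k)
        (λ { as refl → ∂-sem k as 1+k<n }) sp

-- The Schubert polynomial of a shifted permutation

-- The product s_1 ⋯ s_j, in one-line notation 2, 3, ..., j+1, 1. Cancelling its last letter leaves
-- `cycle j` from `cycle (suc j)`, in the order in which `T` applies the divided differences.
cycle : ℕ → Sℤ
cycle zero    = idˢ
cycle (suc j) = cycle j ∙ s +[1+ j ]

cycle-≤0 : ∀ j i → i ℤ.≤ 0ℤ → cycle j ⟨$⟩ i ≡ i
cycle-≤0 zero    i _   = refl
cycle-≤0 (suc j) i i≤0 = trans (cong (cycle j ⟨$⟩_) (s-fixes-≤0 j i i≤0)) (cycle-≤0 j i i≤0)

cycle-> : ∀ j i → j ℕ.< i → cycle j ⟨$⟩ +[1+ i ] ≡ +[1+ i ]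
cycle-> zero    i _   = refl
cycle-> (suc j) i j<i = trans
  (cong (cycle j ⟨$⟩_) (s-fixes (λ { refl → ℕ.<-asym j<i ℕ.≤-refl }) (λ { refl → ℕ.<-irrefl refl j<i })))
  (cycle-> j i (ℕ.<-trans (ℕ.n<1+n j) j<i))

cycle-≡ : ∀ j → cycle j ⟨$⟩ +[1+ j ] ≡ 1ℤ
cycle-≡ zero    = refl
cycle-≡ (suc j) = trans (cong (cycle j ⟨$⟩_) (s-right j)) (cycle-≡ j)

cycle-< : ∀ j i → i ℕ.< j → cycle j ⟨$⟩ +[1+ i ] ≡ +[1+ suc i ]
cycle-< (suc j) i i<1+j with ℕ.m≤n⇒m<n∨m≡n (ℕ.≤-pred i<1+j)
... | inj₂ refl = trans (cong (cycle j ⟨$⟩_) (s-left j)) (cycle-> j (suc j) ℕ.≤-refl)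
... | inj₁ i<j  = trans (cong (cycle j ⟨$⟩_) (s-fixes (ℕ.<⇒≢ i<j) (ℕ.<⇒≢ (ℕ.m<n⇒m<1+n i<j)))) (cycle-< j i i<j)

γˢ-Supported : ∀ {n u} → Supported n u → Supported (suc n) (γˢ u)
γˢ-Supported {n} {u} S = record
  { low  = λ i i≤0 → trans (cong sucℤ (low S (ℤ.pred i) (ℤ.≤-trans (ℤ.pred-mono i≤0) ℤ.-≤+))) (ℤ.suc-pred i)
  ; high = λ { (suc k) (s≤s n≤k) → cong sucℤ (high S k n≤k) } }

γˢ-1 : ∀ {n u} → Supported n u → γˢ u ⟨$⟩ 1ℤ ≡ 1ℤ
γˢ-1 S = cong sucℤ (low S 0ℤ ℤ.≤-refl)

-- the permutation u(1)+1, …, u(n)+1, 1 of {1, …, n+1}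
extend : ℕ → Sℤ → Sℤ
extend n u = γˢ u ∙ cycle n

extend-< : ∀ n u k → k ℕ.< n → extend n u ⟨$⟩ +[1+ k ] ≡ sucℤ (u ⟨$⟩ +[1+ k ])
extend-< n u k k<n = cong (γˢ u ⟨$⟩_) (cycle-< n k k<n)

extend-≡ : ∀ {n u} → Supported n u → extend n u ⟨$⟩ +[1+ n ] ≡ 1ℤ
extend-≡ {n} {u} S = trans (cong (γˢ u ⟨$⟩_) (cycle-≡ n)) (γˢ-1 S)

extend-Supported : ∀ {n u} → Supported n u → Supported (suc n) (extend n u)
extend-Supported {n} {u} S = Supported-∙ (γˢ u) (cycle n) (γˢ-Supported S)
  (record { low = cycle-≤0 n ; high = cycle-> n })

extend-≈ : ∀ {n u v} → Supported n u → Supported (suc n) v →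
  (∀ k → k ℕ.< n → sucℤ (u ⟨$⟩ +[1+ k ]) ≡ v ⟨$⟩ +[1+ k ]) → 1ℤ ≡ v ⟨$⟩ +[1+ n ] → extend n u ≈ˢ v
extend-≈ {n} {u} {v} S S′ eq last = ≈ˢ-within (extend-Supported S) S′ within
  where
  within : ∀ k → k ℕ.< suc n → extend n u ⟨$⟩ +[1+ k ] ≡ v ⟨$⟩ +[1+ k ]
  within k k<1+n with ℕ.m≤n⇒m<n∨m≡n (ℕ.≤-pred k<1+n)
  ... | inj₁ k<n  = trans (extend-< n u k k<n) (eq k k<n)
  ... | inj₂ refl = trans (extend-≡ S) last

-- As e_n(x_1…x_n) is symmetric, multiplying by it commutes with the ∂_k, k < n.
Schubert-extend : ∀ {n u f} → Schubert n u f → Schubert (suc n) (extend n u) (ε n n * f)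
Schubert-extend {n} {u} P@(top eq f≈) = top
  (extend-≈ (Schubert-Supported P) (Supported-w₀ (suc n))
    (λ k k<n → trans (cong sucℤ (trans (eq _) (w₀-inside n k k<n)))
      (sym (trans (w₀-inside (suc n) k (ℕ.m<n⇒m<1+n k<n)) (cong +[1+_] (ℕ.+-∸-assoc 1 k<n)))))
    (sym (trans (w₀-inside (suc n) n ℕ.≤-refl) (cong +[1+_] (ℕ.n∸n≡0 n)))))
  (≈-trans (*-congˡ f≈) (≈-sym (staircase-suc n)))
Schubert-extend {n} {u} P@(down k {v} {g} 1+k<n P′ desc eq f≈) = down k (ℕ.m<n⇒m<1+n 1+k<n) (Schubert-extend P′)
  (subst₂ ℤ._<_ (sym (extend-< n v (suc k) 1+k<n)) (sym (extend-< n v k k<n)) (ℤ.+-monoʳ-< 1ℤ desc))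
  (extend-≈ (Schubert-Supported P)
    (Supported-∙ (extend n v) (s +[1+ k ]) (extend-Supported S) (Supported-s k (ℕ.m<n⇒m<1+n 1+k<n)))
    (λ j j<n → let j′ , j′<n , sj = image (s +[1+ k ]) (Supported-s k 1+k<n) j<n in
      trans (cong sucℤ (trans (eq _) (cong (v ⟨$⟩_) sj)))
        (sym (trans (cong (extend n v ⟨$⟩_) sj) (extend-< n v j′ j′<n))))
    (sym (trans (cong (extend n v ⟨$⟩_) (high (Supported-s k 1+k<n) n ℕ.≤-refl)) (extend-≡ S))))
  (≈-trans (*-congˡ f≈) (≈-sym (∂-Symmetric-* k g (ε-Symmetric-> k n n 1+k<n))))
  where
  S = Schubert-Supported P′
  k<n = ℕ.<-trans (ℕ.n<1+n k) 1+k<n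

-- In `γˢ u ∙ cycle (suc j)` the least value 1 stands at position j+2, so positions j+1 and j+2 form
-- a descent; removing it gives `γˢ u ∙ cycle j`.
Schubert-γˢ : ∀ {n u f} → Schubert n u f → Schubert (suc n) (γˢ u) (T n (ε n n * f))
Schubert-γˢ {n} {u} P = go n ℕ.≤-refl (Schubert-extend P)
  where
  S = Schubert-Supported P
  go : ∀ j → j ℕ.≤ n → ∀ {f} → Schubert (suc n) (γˢ u ∙ cycle j) f → Schubert (suc n) (γˢ u) (T j f)
  go zero    _   P = Schubert-cong (λ _ → refl) ≈-refl P
  go (suc j) j<n P with image u S j<n
  ... | i , _ , u-j = go j (ℕ.<⇒≤ j<n) (down j (s≤s j<n) P
    (subst₂ ℤ._<_
      (sym (trans (cong (γˢ u ⟨$⟩_) (cycle-≡ (suc j))) (γˢ-1 S)))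
      (sym (trans (cong (γˢ u ⟨$⟩_) (cycle-< (suc j) j ℕ.≤-refl)) (cong sucℤ u-j)))
      (ℤ.+<+ (s≤s (s≤s z≤n))))
    (λ i → sym (∙-s-s (γˢ u ∙ cycle j) +[1+ j ] i)) ≈-refl)

-- Indices, admissibility and shifted monomials

-- Lists are read from the end, as in sem.
entry : List ℕ → ℕ → ℕ
entry []       j = 0
entry (p ∷ as) j with j ℕ.≟ length as
... | yes _ = p
... | no  _ = entry as j

entry-≡ : ∀ p as → entry (p ∷ as) (length as) ≡ p
entry-≡ p as with length as ℕ.≟ length as
... | yes _ = refl
... | no ≢  = ⊥-elim (≢ refl)

entry-≢ : ∀ p as {j} → j ≢ length as → entry (p ∷ as) j ≡ entry as j
entry-≢ p as {j} j≢ with j ℕ.≟ length as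
... | yes j≡ = ⊥-elim (j≢ j≡)
... | no _   = refl

entry-≥ : ∀ as j → length as ℕ.≤ j → entry as j ≡ 0
entry-≥ []       j _  = refl
entry-≥ (p ∷ as) j lt = trans (entry-≢ p as (λ { refl → ℕ.<-irrefl refl lt })) (entry-≥ as j (ℕ.<⇒≤ lt))

entry≤sum : ∀ as j → entry as j ℕ.≤ sum as
entry≤sum []       j = z≤n
entry≤sum (p ∷ as) j with j ℕ.≟ length as
... | yes _ = ℕ.m≤m+n p (sum as)
... | no  _ = ℕ.≤-trans (entry≤sum as j) (ℕ.m≤n+m (sum as) p)

entry-injective : ∀ as bs → length as ≡ length bs → (∀ j → entry as j ≡ entry bs j) → as ≡ bs
entry-injective []       []       _   _  = refl
entry-injective (p ∷ as) (q ∷ bs) len eq = cong₂ _∷_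
  (trans (sym (entry-≡ p as)) (trans (eq (length as))
    (trans (cong (entry (q ∷ bs)) len′) (entry-≡ q bs))))
  (entry-injective as bs len′ tails)
  where
  len′ = ℕ.suc-injective len
  tails : ∀ j → entry as j ≡ entry bs j
  tails j with j ℕ.≟ length as
  ... | yes j≡ = trans (entry-≥ as j (ℕ.≤-reflexive (sym j≡)))
                   (sym (entry-≥ bs j (ℕ.≤-reflexive (trans (sym len′) (sym j≡)))))
  ... | no  j≢ = trans (sym (entry-≢ p as j≢))
                   (trans (eq j) (entry-≢ q bs (λ j≡ → j≢ (trans j≡ (sym len′)))))

entryℤ : List ℕ → ℤ → ℕ
entryℤ as (+ j)    = entry as j
entryℤ as -[1+ _ ] = 0

entryℤ-<0 : ∀ as {i} → i ℤ.< 0ℤ → entryℤ as i ≡ 0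
entryℤ-<0 as ℤ.-<+ = refl

-- the entries of as, placed at the indices -b, 1-b, 2-b, …
index : ℕ → List ℕ → 𝒞
index b as = record
  { at      = λ i → entryℤ as (i ℤ.+ + b)
  ; bound   = length as ℕ.+ b
  ; support = outside
  }
  where
  outside : ∀ i → length as ℕ.+ b ℕ.< ∣ i ∣ → entryℤ as (i ℤ.+ + b) ≡ 0
  outside (+ k)    lt = entry-≥ as (k ℕ.+ b)
    (ℕ.≤-trans (ℕ.m≤m+n (length as) b) (ℕ.≤-trans (ℕ.<⇒≤ lt) (ℕ.m≤m+n k b)))
  outside -[1+ k ] lt = entryℤ-<0 as (subst (-[1+ k ] ℤ.+ + b ℤ.<_) (ℤ.+-inverseˡ (+ b))
    (ℤ.+-monoˡ-< (+ b) (ℤ.neg-mono-< (ℤ.+<+ (ℕ.≤-<-trans (ℕ.m≤n+m b (length as)) lt)))))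

index-injective : ∀ b {as bs} → length as ≡ length bs → at (index b as) ≗ at (index b bs) → as ≡ bs
index-injective b {as} {bs} len eq = entry-injective as bs len
  (λ j → subst (λ i → entryℤ as i ≡ entryℤ bs i) (back j) (eq (+ j ℤ.- + b)))
  where
  back : ∀ j → + j ℤ.- + b ℤ.+ + b ≡ + j
  back j = trans (ℤ.+-assoc (+ j) (ℤ.- + b) (+ b)) (trans (cong (λ i → + j ℤ.+ i) (ℤ.+-inverseˡ (+ b))) (ℤ.+-identityʳ _))

pred-minus : ∀ i m → ℤ.pred i ℤ.- + m ≡ i ℤ.- + suc m
pred-minus i m = begin
  (ℤ.-1ℤ ℤ.+ i) ℤ.- + m        ≡⟨ cong (ℤ._- + m) (ℤ.+-comm ℤ.-1ℤ i) ⟩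
  (i ℤ.+ ℤ.-1ℤ) ℤ.- + m        ≡⟨ ℤ.+-assoc i ℤ.-1ℤ (ℤ.- + m) ⟩
  i ℤ.+ (ℤ.-1ℤ ℤ.- + m)        ≡⟨ cong (λ j → i ℤ.+ j) (ℤ.neg-distrib-+ 1ℤ (+ m)) ⟨
  i ℤ.- + suc m                ∎
  where open ≡-Reasoning

at-γ^ : ∀ m α i → at (γ^ m α) i ≡ at α (i ℤ.- + m)
at-γ^ zero    α i = cong (at α) (sym (ℤ.+-identityʳ i))
at-γ^ (suc m) α i = trans (at-γ^ m α (ℤ.pred i)) (cong (at α) (pred-minus i m))

bound-γ^ : ∀ m α → 𝒞.bound (γ^ m α) ≡ m ℕ.+ 𝒞.bound α
bound-γ^ zero    α = refl
bound-γ^ (suc m) α = cong suc (bound-γ^ m α)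

at-γ^-index : ∀ m b as i → at (γ^ (m ℕ.+ b) (index b as)) i ≡ entryℤ as (i ℤ.- + m)
at-γ^-index m b as i = trans (at-γ^ (m ℕ.+ b) (index b as) i) (cong (entryℤ as) (begin
  i ℤ.- + (m ℕ.+ b) ℤ.+ + b               ≡⟨ cong (λ j → i ℤ.+ j ℤ.+ + b) (ℤ.neg-distrib-+ (+ m) (+ b)) ⟩
  i ℤ.+ (ℤ.- + m ℤ.- + b) ℤ.+ + b         ≡⟨ ℤ.+-assoc i _ (+ b) ⟩
  i ℤ.+ ((ℤ.- + m ℤ.- + b) ℤ.+ + b)       ≡⟨ cong (λ j → i ℤ.+ j) (ℤ.+-assoc (ℤ.- + m) (ℤ.- + b) (+ b)) ⟩
  i ℤ.+ (ℤ.- + m ℤ.+ (ℤ.- + b ℤ.+ + b))   ≡⟨ cong (λ j → i ℤ.+ (ℤ.- + m ℤ.+ j)) (ℤ.+-inverseˡ (+ b)) ⟩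
  i ℤ.+ (ℤ.- + m ℤ.+ 0ℤ)                  ≡⟨ cong (λ j → i ℤ.+ j) (ℤ.+-identityʳ (ℤ.- + m)) ⟩
  i ℤ.- + m                               ∎))
  where open ≡-Reasoning

-- The shift by `suc m ℕ.+ b` moves the start of the list from -b to m+1, which keeps the support
-- positive.
module Shifted (m b : ℕ) (as : List ℕ) where

  shifted : 𝒞
  shifted = γ^ (suc m ℕ.+ b) (index b as)

  at-≤0 : ∀ i → i ℤ.≤ 0ℤ → at shifted i ≡ 0
  at-≤0 i i≤0 = trans (at-γ^-index (suc m) b as i)
    (entryℤ-<0 as (ℤ.+-mono-≤-< i≤0 (ℤ.-<+ {m} {0})))

  at-low : ∀ k → k ℕ.< m → at shifted +[1+ k ] ≡ 0
  at-low k k<m = trans (at-γ^-index (suc m) b as +[1+ k ]) (entryℤ-<0 as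
    (subst (+[1+ k ] ℤ.- +[1+ m ] ℤ.<_) (ℤ.+-inverseʳ +[1+ m ]) (ℤ.+-monoˡ-< (ℤ.- +[1+ m ]) (ℤ.+<+ (s≤s k<m)))))

  at-entry : ∀ j → at shifted +[1+ m ℕ.+ j ] ≡ entry as j
  at-entry j = trans (at-γ^-index (suc m) b as +[1+ m ℕ.+ j ]) (cong (entryℤ as)
    (trans (ℤ.⊖-≥ {suc (m ℕ.+ j)} {suc m} (s≤s (ℕ.m≤m+n m j))) (cong +_ (ℕ.m+n∸m≡n m j))))

  -- An entry is at most the degree, hence at most m, while the window contains only indices above
  -- m.
  shifted-Admissible : sum as ℕ.≤ m → Admissible shifted
  shifted-Admissible le = record { positive = at-≤0 ; bounded = bounded }
    where
    bounded : ∀ i → 1ℤ ℤ.≤ i → + at shifted i ℤ.≤ i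
    bounded (+ zero) (ℤ.+≤+ ())
    bounded +[1+ k ] _ with k ℕ.<? m
    ... | yes k<m = subst (λ x → + x ℤ.≤ +[1+ k ]) (sym (at-low k k<m)) (ℤ.+≤+ z≤n)
    ... | no  k≮m = ℤ.+≤+ (begin
      at shifted +[1+ k ]                        ≡⟨ cong (λ l → at shifted +[1+ l ]) (ℕ.m+[n∸m]≡n (ℕ.≮⇒≥ k≮m)) ⟨
      at shifted +[1+ m ℕ.+ (k ℕ.∸ m) ]          ≡⟨ at-entry (k ℕ.∸ m) ⟩
      entry as (k ℕ.∸ m)                         ≤⟨ entry≤sum as (k ℕ.∸ m) ⟩
      sum as                                     ≤⟨ le ⟩
      m                                          ≤⟨ ℕ.≮⇒≥ k≮m ⟩
      k                                          ≤⟨ ℕ.n≤1+n k ⟩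
      suc k                                      ∎)
      where open ℕ.≤-Reasoning

  private
    factor : ℕ → Poly
    factor k = e (at shifted +[1+ k ]) (suc k)

    factor-1 : ∀ k → at shifted +[1+ k ] ≡ 0 → factor k ≈ 1ᴾ
    factor-1 k eq = ≈-trans (≡⇒≈ (cong (λ p → e p (suc k)) eq)) (e≈ε 0 (suc k))

    below : ∀ k → k ℕ.≤ m → ∏ (map factor (upTo k)) ≈ 1ᴾ
    below zero    _   = ≈-refl
    below (suc k) k<m = ≈-trans (∏-upTo-suc factor k)
      (≈-trans (*-cong (below k (ℕ.<⇒≤ k<m)) (factor-1 k (at-low k k<m))) (*-identityˡ _))

    -- Induction over the tails of `as` with `factor` fixed. As lists are read from the end, a tail
    -- has the same entries as `as` wherever it is defined.
    window : ∀ bs → (∀ j → j ℕ.< length bs → entry as j ≡ entry bs j) →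
      ∏ (map factor (upTo (m ℕ.+ length bs))) ≈ sem (suc m) bs
    window [] _ = subst (λ l → ∏ (map factor (upTo l)) ≈ 1ᴾ) (sym (ℕ.+-identityʳ m)) (below m ℕ.≤-refl)
    window (p ∷ bs) agree rewrite ℕ.+-suc m (length bs) = begin
      ∏ (map factor (upTo (suc k)))     ≈⟨ ∏-upTo-suc factor k ⟩
      ∏ (map factor (upTo k)) * factor k ≈⟨ *-cong
        (window bs (λ j j< → trans (agree j (ℕ.m<n⇒m<1+n j<)) (entry-≢ p bs (ℕ.<⇒≢ j<))))
        (≈-trans (≡⇒≈ (cong (λ q → e q (suc k)) (trans (at-entry (length bs)) (trans (agree (length bs) ℕ.≤-refl) (entry-≡ p bs)))))
          (e≈ε p (suc k))) ⟩
      sem (suc m) bs * ε p (suc k)      ≈⟨ *-comm _ _ ⟩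
      ε p (suc k) * sem (suc m) bs      ∎
      where open ≈-Reasoning
            k = m ℕ.+ length bs

    above : ∀ x → ∏ (map factor (upTo (x ℕ.+ (m ℕ.+ length as)))) ≈ sem (suc m) as
    above zero    = window as (λ _ _ → refl)
    above (suc x) = ≈-trans (∏-upTo-suc factor k)
      (≈-trans (*-cong (above x) (factor-1 k vanishes)) (P.*-identityʳ _))
      where
      k = x ℕ.+ (m ℕ.+ length as)
      reorder : m ℕ.+ (x ℕ.+ length as) ≡ k
      reorder = trans (sym (ℕ.+-assoc m x _)) (trans (cong (ℕ._+ length as) (ℕ.+-comm m x)) (ℕ.+-assoc x m _))
      vanishes : at shifted +[1+ k ] ≡ 0
      vanishes = trans (cong (λ l → at shifted +[1+ l ]) (sym reorder))
        (trans (at-entry (x ℕ.+ length as)) (entry-≥ as _ (ℕ.m≤n+m _ x)))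

  SEM-shifted : SEM shifted ≈ sem (suc m) as
  -- The bound of the shifted index exceeds the end of the window by `suc (b ℕ.+ b)`; the factors in
  -- between are e_0 = 1.
  SEM-shifted = subst (λ l → ∏ (map factor (upTo l)) ≈ sem (suc m) as) (sym bound-eq) (above (suc (b ℕ.+ b)))
    where
    bound-eq : 𝒞.bound shifted ≡ suc (b ℕ.+ b) ℕ.+ (m ℕ.+ length as)
    bound-eq = trans (bound-γ^ (suc m ℕ.+ b) (index b as)) (cong suc
      (S.solve 3 (λ m b l → (m S.:+ b) S.:+ (l S.:+ b) S.:= (b S.:+ b) S.:+ (m S.:+ l)) refl m b (length as)))
      where module S = ℕ.+-*-Solver

open Shifted using (shifted-Admissible; SEM-shifted)

-- The lists expand the polynomial of `γˢ^ b w` on a window starting at 0; starting at -b instead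
-- makes them indices for w itself.
indexed : ℕ → List (List ℕ × ℚ) → List (𝒞 × ℚ)
indexed b = map (λ t → index b (proj₁ t) , proj₂ t)

indexed-combination : ∀ m b ts →
  SEMcombination (shiftIndices (suc m ℕ.+ b) (indexed b ts)) ≈ ⟦ ts ⟧ (suc m)
indexed-combination m b []              = ≈-refl
indexed-combination m b ((as , c) ∷ ts) =
  +-cong (*-congˡ (SEM-shifted m b as)) (indexed-combination m b ts)

indexed-Unique : ∀ {n} b {ts} → All (λ t → length (proj₁ t) ≡ n) ts →
  AllPairs (λ t u → proj₁ t ≢ proj₁ u) ts → Unique (map proj₁ (indexed b ts))
indexed-Unique b []          []         = []
indexed-Unique b (len ∷ lens) (≢s ∷ ds) =
  All.map⁺ (All.map⁺ (All.zipWith (λ (≢ , len′) eq → ≢ (index-injective b (trans len (sym len′)) eq)) (≢s , lens)))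
  ∷ indexed-Unique b lens ds

-- Iterated shifts and stability

γˢ^-⟨$⟩ : ∀ m w i → γˢ^ m w ⟨$⟩ i ≡ + m ℤ.+ (w ⟨$⟩ (i ℤ.- + m))
γˢ^-⟨$⟩ zero    w i = sym (trans (ℤ.+-identityˡ _) (cong (w ⟨$⟩_) (ℤ.+-identityʳ i)))
γˢ^-⟨$⟩ (suc m) w i = trans (cong sucℤ (γˢ^-⟨$⟩ m w (ℤ.pred i)))
  (trans (sym (ℤ.+-assoc 1ℤ (+ m) (w ⟨$⟩ (ℤ.pred i ℤ.- + m)))) (cong (λ j → + suc m ℤ.+ (w ⟨$⟩ j)) (pred-minus i m)))

-- The permutation w moves only integers between -b and b, and a shift by b+1 takes these to 1, ...,
-- 2b+1.
γˢ^-Supported : ∀ w → let b = Sℤ.bound w in Supported (suc (b ℕ.+ b)) (γˢ^ (suc b) w)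
γˢ^-Supported w = record { low = low′ ; high = high′ }
  where
  b = Sℤ.bound w
  fixed : ∀ i → b ℕ.< ∣ i ℤ.- +[1+ b ] ∣ → γˢ^ (suc b) w ⟨$⟩ i ≡ i
  fixed i lt = begin
    γˢ^ (suc b) w ⟨$⟩ i                       ≡⟨ γˢ^-⟨$⟩ (suc b) w i ⟩
    +[1+ b ] ℤ.+ (w ⟨$⟩ (i ℤ.- +[1+ b ]))     ≡⟨ cong (λ j → +[1+ b ] ℤ.+ j) (Sℤ.fixes w _ lt) ⟩
    +[1+ b ] ℤ.+ (i ℤ.- +[1+ b ])             ≡⟨ ℤ.+-comm +[1+ b ] (i ℤ.- +[1+ b ]) ⟩
    (i ℤ.- +[1+ b ]) ℤ.+ +[1+ b ]             ≡⟨ ℤ.+-assoc i (ℤ.- +[1+ b ]) +[1+ b ] ⟩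
    i ℤ.+ (ℤ.- +[1+ b ] ℤ.+ +[1+ b ])         ≡⟨ cong (λ j → i ℤ.+ j) (ℤ.+-inverseˡ +[1+ b ]) ⟩
    i ℤ.+ 0ℤ                                  ≡⟨ ℤ.+-identityʳ i ⟩
    i                                         ∎
    where open ≡-Reasoning
  low′ : γˢ^ (suc b) w ∈S∞
  low′ (+ zero) _ = fixed 0ℤ ℕ.≤-refl
  low′ -[1+ k ] _ = fixed -[1+ k ] (s≤s (ℕ.m≤n⇒m≤1+n (ℕ.m≤n+m b k)))
  low′ +[1+ k ] (ℤ.+≤+ ())
  high′ : ∀ k → suc (b ℕ.+ b) ℕ.≤ k → γˢ^ (suc b) w ⟨$⟩ +[1+ k ] ≡ +[1+ k ]
  high′ k lt = fixed +[1+ k ] (subst (b ℕ.<_) (sym (cong ∣_∣ (ℤ.⊖-≥ {suc k} {suc b} (s≤s b≤k))))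
    (ℕ.m+n≤o⇒m≤o∸n (suc b) lt))
    where b≤k = ℕ.≤-trans (ℕ.m≤n+m b (suc b)) lt

-- The bound d persists because T k lowers degrees by exactly k.
Schubert-γˢ-Span : ∀ {m n d u f} → Schubert (m ℕ.+ n) u f →
  Span m (λ as → length as ≡ n × sum as ℕ.≤ d) f →
  Σ[ g ∈ Poly ] Schubert (suc m ℕ.+ n) (γˢ u) g × Span (suc m) (λ as → length as ≡ n × sum as ℕ.≤ d) g
Schubert-γˢ-Span {m} {n} P sp = _ , Schubert-γˢ P ,
  Span-map (∘-linear (T-linear (m ℕ.+ n)) (*ˡ-linear (ε (m ℕ.+ n) (m ℕ.+ n))))
    (λ { as (refl , le) → Span-weaken
      (λ bs (len , tot) → len , ℕ.≤-trans (ℕ.≤-reflexive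
        (ℕ.+-cancelʳ-≡ _ (sum bs) (sum as) (trans tot (ℕ.+-comm _ (sum as))))) le)
      (T-sem m as (m ℕ.+ n)) })
    sp

γˢ^-Schubert : ∀ {n d u f} → Schubert n u f → Span 0 (λ as → length as ≡ n × sum as ℕ.≤ d) f → ∀ m →
  Σ[ g ∈ Poly ] Schubert (m ℕ.+ n) (γˢ^ m u) g × Span m (λ as → length as ≡ n × sum as ℕ.≤ d) g
γˢ^-Schubert P sp zero    = _ , P , sp
γˢ^-Schubert P sp (suc m) = let _ , P′ , sp′ = γˢ^-Schubert P sp m in Schubert-γˢ-Span P′ sp′

γˢ^-stable : ∀ {n m u ts} → All (λ t → length (proj₁ t) ≡ n × sum (proj₁ t) ℕ.< m) ts →
  Schubert (m ℕ.+ n) (γˢ^ m u) (⟦ ts ⟧ m) → ∀ j → Schubert (j ℕ.+ m ℕ.+ n) (γˢ^ (j ℕ.+ m) u) (⟦ ts ⟧ (j ℕ.+ m))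
γˢ^-stable A P zero    = P
γˢ^-stable {n} {m} {ts = ts} A P (suc j) = Schubert-cong (λ _ → refl)
  (T-⟦⟧-shift (j ℕ.+ m) n ts (All.map (map₂ (λ lt → ℕ.≤-trans lt (ℕ.m≤n+m m j))) A))
  (Schubert-γˢ (γˢ^-stable A P j))

corollary3p8 : (w : Sℤ) →
    Σ[ m₀ ∈ ℕ ] Σ[ ts ∈ List (𝒞 × ℚ) ]
    Unique (map proj₁ ts) ×
    All (λ t → proj₂ t ≢ 0ℚ) ts ×
    ((m : ℕ) → m₀ ≤ m →
    (γˢ^ m w ∈S∞) ×
    All (λ t → Admissible (γ^ m (proj₁ t))) ts ×
    IsSchubert (γˢ^ m w) (SEMcombination (shiftIndices m ts)))
corollary3p8 w =
  let f , P , sp       = Schubert-exists (γˢ^ b w) (γˢ^-Supported w)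
      d , sp′          = Span-bounded sp
      -- After `suc d` shifts the window starts above every degree, the hypothesis of `T-sem-shift`.
      g , P′ , sp″     = γˢ^-Schubert P sp′ (suc d)
      ts , N , A , g≈  = normalise sp″
      stable           = γˢ^-stable {ts = ts} (All.map (map₂ s≤s) A) (Schubert-cong (λ _ → refl) g≈ P′)
  -- The threshold: b shifts to enter S_∞, then `suc d` to reach stability.
  in suc d ℕ.+ b , indexed b ts
    , indexed-Unique b (All.map proj₁ A) (Normal.distinct N)
    , All.map⁺ (Normal.nonzero N)
    , λ m m₀≤m → let j = m ℕ.∸ (suc d ℕ.+ b) in
        subst (Conclusion ts) (trans (ℕ.+-assoc j (suc d) b) (ℕ.m∸n+n≡m m₀≤m))
          (conclude ts (j ℕ.+ suc d) (ℕ.m≤n+m (suc d) j) A (stable j))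
  where
  b = suc (Sℤ.bound w)
  Conclusion : List (List ℕ × ℚ) → ℕ → Set
  Conclusion ts m = (γˢ^ m w ∈S∞) × All (λ t → Admissible (γ^ m (proj₁ t))) (indexed b ts) ×
    IsSchubert (γˢ^ m w) (SEMcombination (shiftIndices m (indexed b ts)))
  conclude : ∀ {n n′ d} ts m → d ℕ.< m → All (λ t → length (proj₁ t) ≡ n × sum (proj₁ t) ℕ.≤ d) ts →
    Schubert n′ (γˢ^ m (γˢ^ b w)) (⟦ ts ⟧ m) → Conclusion ts (m ℕ.+ b)
  -- Here d < m rules out m = 0, so the window starts at a positive index; `fold-+` joins the shifts
  -- by `suc m` and by b.
  conclude {n′ = n′} ts (suc m) (s≤s d≤m) A P =
      low (Schubert-Supported P′)
    , All.map⁺ (All.map (λ {t} (_ , le) → shifted-Admissible m b (proj₁ t) (ℕ.≤-trans le d≤m)) A)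
    , Schubert⇒IsSchubert (Schubert-cong (λ _ → refl) (≈-sym (indexed-combination m b ts)) P′)
    where P′ = subst (λ u → Schubert n′ u (⟦ ts ⟧ (suc m))) (sym (fold-+ w γˢ (suc m))) P
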